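{- Let $D=(V,A)$ be a finite simple digraph with $n>2$ vertices. If $d^+(u)+d^-(v)\geq n+2$ for all vertices $u,v\in V$ with $\langle u,v\rangle\notin A$, then $D$ contains at least two pairwise arc-disjoint Hamiltonian cycles.
   Context: Digraphs are finite and simple: no multiple arcs and no self-loops (both $\langle u,v\rangle$ and $\langle v,u\rangle$ may be present). $\langle u,v\rangle$ denotes the arc from $u$ to $v$; $d^+(u)$ and $d^-(u)$ denote the out-degree and in-degree of $u$. A Hamiltonian cycle of a digraph is a simple directed cycle through all its vertices. Hamiltonian cycles are arc-disjoint if they share no arc. -}

module Defs where

open import Data.Nat using (ℕ)
open import Data.Fin using (Fin)
open import Data.List using (List; []; _∷_; _∷ʳ_; zip; length; filter; allFin)
open import Data.List.Membership.Propositional using (_∈_)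
open import Data.List.Relation.Unary.All using (All)
open import Data.List.Relation.Unary.Unique.Propositional using (Unique)
open import Data.List.Relation.Binary.Disjoint.Propositional using (Disjoint)
open import Data.Product using (_×_; uncurry)
open import Level using (0ℓ)
open import Relation.Binary.Core using (Rel)
open import Relation.Binary.Definitions using (Decidable)
open import Relation.Nullary using (¬_)

-- Arcs form a binary relation on the vertex set, so there are no multiple
-- arcs; u ⟶ v and v ⟶ u may both hold.
record Digraph (n : ℕ) : Set₁ where
  infix 4 _⟶_ _⟶?_
  field
    _⟶_    : Rel (Fin n) 0ℓ
    _⟶?_   : Decidable _⟶_
    noLoop : ∀ u → ¬ (u ⟶ u)

  outDegree : Fin n → ℕ
  outDegree u = length (filter (λ v → u ⟶? v) (allFin n))

  inDegree : Fin n → ℕ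
  inDegree v = length (filter (λ u → u ⟶? v) (allFin n))

-- cyclicPairs x₀ (x₁ ∷ … ∷ xₖ ∷ []) = (x₀ , x₁) ∷ (x₁ , x₂) ∷ … ∷ (xₖ , x₀) ∷ []
cyclicPairs : ∀ {A : Set} → A → List A → List (A × A)
cyclicPairs x xs = zip (x ∷ xs) (xs ∷ʳ x)

module _ {n : ℕ} (D : Digraph n) where
  open Digraph D

  record SimpleCycle : Set where
    field
      first : Fin n
      rest  : List (Fin n)

    vertices : List (Fin n)
    vertices = first ∷ rest

    arcs : List (Fin n × Fin n)
    arcs = cyclicPairs first rest

    field
      distinct : Unique vertices
      arcsInD  : All (uncurry _⟶_) arcs

  record HamiltonianCycle : Set where
    field
      cycle    : SimpleCycle
    open SimpleCycle cycle public
    field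
      spanning : ∀ v → v ∈ vertices

  ArcDisjoint : HamiltonianCycle → HamiltonianCycle → Set
  ArcDisjoint C₁ C₂ = Disjoint (HamiltonianCycle.arcs C₁) (HamiltonianCycle.arcs C₂)

{-# OPTIONS --safe #-}
module Submission where

-- Both cycles come from one theorem (Ore.¬¬hamiltonian): a digraph is Hamiltonian if
-- d⁺(u) + d⁻(v) ≥ n for all distinct u, v with neither u ⟶ v nor M u v, where M is an injective
-- partial function without fixed points and 2-cycles.  M = ∅ yields C₁; then deleting the arcs
-- of C₁ lowers every degree by one, and M = arcs of C₁ yields C₂.
--
-- Suppose there is no Hamiltonian cycle.  Take a longest cycle Q ++ G and a path P outside it
-- such that Q ++ P is a cycle too, with G as short as possible.  Inserting a block of G between
-- consecutive vertices of Q would give a longer cycle, so the degrees of the ends of the block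
-- and of P are small; counting contradicts the degree condition unless M links an end of G
-- with P.  Then P is a single vertex y, and some end x of G linked to y can be left out in its
-- place, giving another longest cycle.  If further vertices are missed by both cycles, their
-- degrees again contradict the condition.  If not, choose y with the least out-degree among all
-- vertices missed by a cycle of length n − 1; this forces M y x.  Along the Hamiltonian path of
-- the other vertices, all out-neighbours of y precede its in-neighbours, and the same holds for
-- x, whence one can splice both y and x into the path.

open import Defs
open import Data.Nat using (ℕ; zero; suc; _+_; _≤_; _<_; _>_; _≥_; z≤n; s≤s; s≤s⁻¹)
open import Data.Nat.Properties
open import Data.Nat.Induction using (<-rec)
open import Data.Nat.Tactic.RingSolver using (solve-∀)
open import Data.Fin using (Fin)
import Data.Fin.Properties as Fin using (any?; all?; _≟_)
open import Data.Empty using (⊥; ⊥-elim)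
open import Data.List using (List; []; _∷_; _++_; _∷ʳ_; [_]; length; filter; allFin; zip)
open import Data.List.Properties
  using (filter-++; filter-none; filter-notAll; length-filter; length-++; length-tabulate; ++-assoc; ++-identityʳ)
open import Data.List.Membership.Propositional using (_∈_; find)
open import Data.List.Membership.Propositional.Properties
  using (∈-++⁺ˡ; ∈-++⁺ʳ; ∈-++⁻; ∈-∃++; ∈-allFin)
open import Data.List.Relation.Unary.All as All using (All; []; _∷_)
import Data.List.Relation.Unary.All.Properties as All
open import Data.List.Relation.Unary.Any as Any using (Any; here; there; any?)
open import Data.List.Relation.Unary.AllPairs using (AllPairs; []; _∷_)
open import Data.List.Relation.Unary.Unique.Propositional using (Unique)
open import Data.List.Relation.Unary.Unique.Propositional.Properties using (allFin⁺)
open import Data.List.Relation.Binary.Permutation.Propositional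
  using (_↭_; ↭-refl; ↭-sym; ↭-trans; ↭-reflexive; ↭⇒↭ₛ)
open import Data.List.Relation.Binary.Permutation.Propositional.Properties
  using (↭-length; ↭-singleton-inv; filter-↭; ∈-resp-↭; ++⁺ʳ; ++⁺ˡ; ++-commutativeMonoid; shift; ∷↭∷ʳ)
import Data.List.Relation.Binary.Permutation.Setoid.Properties as PermS
open import Data.Product using (_×_; _,_; ∃; ∃₂; proj₁; proj₂; uncurry)
open import Data.Product.Properties using (≡-dec)
open import Data.Sum using (_⊎_; inj₁; inj₂; [_,_]′)
open import Level using (0ℓ)
open import Relation.Binary.Core using (Rel)
open import Relation.Binary.Definitions using () renaming (Decidable to Decidable₂)
open import Relation.Binary.PropositionalEquality
  using (_≡_; _≢_; refl; sym; trans; cong; cong₂; subst; subst₂; setoid)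
open import Relation.Nullary using (¬_; Dec; yes; no; ¬?; _×-dec_; decidable-stable)
open import Relation.Unary using (Pred; Decidable)

-- Certificates for linear inequalities

infixr 4 _⊞_
_⊞_ : ∀ {a b c d} → a ≤ b → c ≤ d → a + c ≤ b + d
_⊞_ = +-mono-≤

opaque
  -- Refutes a sum `l ≤ r` of hypotheses whose left side exceeds the right one by `suc k`; the
  -- contradictory degree counts end here.
  overfull : ∀ {l r} k → l ≤ r → l ≡ suc k + r → ⊥
  overfull {r = r} k l≤r refl = <⇒≱ (s≤s (m≤n+m r k)) l≤r

  -- Here `a ≤ b` is the sum of the hypotheses, `k` the slack, and the equation a ring identity.
  derive : ∀ {l r a b} k → a ≤ b → l + b + k ≡ r + a → l ≤ r
  derive {l} {r} {a} {b} k a≤b eq = +-cancelʳ-≤ b l r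
    (≤-trans (m≤m+n (l + b) k) (≤-trans (≤-reflexive eq) (+-monoʳ-≤ r a≤b)))

-- Counting and order in lists

module Lists where

  private variable
    A : Set
    P Q : Pred A 0ℓ
    xs ys : List A
    x y : A

  opaque
    -- Opaque, so that counts remain atoms in the arithmetic.
    # : {P : Pred A 0ℓ} → Decidable P → List A → ℕ
    # P? xs = length (filter P? xs)

  opaque
    unfolding #

    #-def : (P? : Decidable P) (xs : List A) → # P? xs ≡ length (filter P? xs)
    #-def P? xs = refl

    #-++ : (P? : Decidable P) (xs ys : List A) → # P? (xs ++ ys) ≡ # P? xs + # P? ys
    #-++ P? xs ys = trans (cong length (filter-++ P? xs ys)) (length-++ (filter P? xs))

    #-↭ : (P? : Decidable P) → xs ↭ ys → # P? xs ≡ # P? ys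
    #-↭ P? p = ↭-length (filter-↭ P? p)

    #-none : (P? : Decidable P) → (∀ {x} → x ∈ xs → ¬ P x) → # P? xs ≤ 0
    #-none P? none = ≤-reflexive (cong length (filter-none P? (All.tabulate none)))

    #≤length : (P? : Decidable P) (xs : List A) → # P? xs ≤ length xs
    #≤length P? xs = length-filter P? xs

    #<length : (P? : Decidable P) → x ∈ xs → ¬ P x → suc (# P? xs) ≤ length xs
    #<length P? x∈ ¬Px = filter-notAll P? _ (Any.map (λ { refl → ¬Px }) x∈)

    #-single : (P? : Decidable P) (x : A) → # P? [ x ] ≤ 1
    #-single P? x = length-filter P? [ x ]

    #-both : (P? : Decidable P) (Q? : Decidable Q) (x y : A) →
      (P x × Q y) ⊎ # P? [ x ] + # Q? [ y ] ≤ 1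
    #-both P? Q? x y with P? x
    ... | no _ = inj₂ (#-single Q? y)
    ... | yes p with Q? y
    ...   | yes q = inj₁ (p , q)
    ...   | no _ = inj₂ ≤-refl

    #-disjoint : (P? : Decidable P) (Q? : Decidable Q) (xs : List A) →
      (∀ {x} → x ∈ xs → P x → ¬ Q x) → # P? xs + # Q? xs ≤ length xs
    #-disjoint P? Q? [] _ = z≤n
    #-disjoint P? Q? (x ∷ xs) dis with P? x | Q? x | #-disjoint P? Q? xs (λ m → dis (there m))
    ... | yes p | yes q | _ = ⊥-elim (dis (here refl) p q)
    ... | yes _ | no _ | ih = s≤s ih
    ... | no _ | yes _ | ih = ≤-trans (≤-reflexive (+-suc (# P? xs) (# Q? xs))) (s≤s ih)
    ... | no _ | no _ | ih = m≤n⇒m≤1+n ih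

    #-disjoint< : (P? : Decidable P) (Q? : Decidable Q) {xs : List A} → x ∈ xs → ¬ P x → ¬ Q x →
      (∀ {x} → x ∈ xs → P x → ¬ Q x) → suc (# P? xs + # Q? xs) ≤ length xs
    #-disjoint< P? Q? {x ∷ xs} (here refl) ¬p ¬q dis with P? x | Q? x
    ... | yes p | _ = ⊥-elim (¬p p)
    ... | _ | yes q = ⊥-elim (¬q q)
    ... | no _ | no _ = s≤s (#-disjoint P? Q? xs λ m → dis (there m))
    #-disjoint< P? Q? {y ∷ xs} (there x∈) ¬p ¬q dis with P? y | Q? y | #-disjoint< P? Q? x∈ ¬p ¬q (λ m →
        dis (there m))
    ... | yes p | yes q | _ = ⊥-elim (dis (here refl) p q)
    ... | yes _ | no _ | ih = s≤s ih
    ... | no _ | yes _ | ih = s≤s (≤-trans (≤-reflexive (+-suc (# P? xs) (# Q? xs))) ih)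
    ... | no _ | no _ | ih = m≤n⇒m≤1+n ih

    #-cover : {R : Pred A 0ℓ} (P? : Decidable P) (Q? : Decidable Q) (R? : Decidable R) (xs : List A) →
      (∀ {x} → P x → Q x ⊎ R x) → # P? xs ≤ # Q? xs + # R? xs
    #-cover P? Q? R? [] _ = z≤n
    #-cover P? Q? R? (x ∷ xs) cover with P? x | Q? x | R? x | #-cover P? Q? R? xs cover
    ... | yes p | no ¬q | no ¬r | _ = ⊥-elim ([ ¬q , ¬r ]′ (cover p))
    ... | yes _ | yes _ | yes _ | ih = s≤s (≤-trans ih (+-monoʳ-≤ _ (n≤1+n _)))
    ... | yes _ | yes _ | no _ | ih = s≤s ih
    ... | yes _ | no _ | yes _ | ih = ≤-trans (s≤s ih) (≤-reflexive (sym (+-suc _ _)))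
    ... | no _ | yes _ | yes _ | ih = m≤n⇒m≤1+n (≤-trans ih (+-monoʳ-≤ _ (n≤1+n _)))
    ... | no _ | yes _ | no _ | ih = m≤n⇒m≤1+n ih
    ... | no _ | no _ | yes _ | ih = ≤-trans ih (+-monoʳ-≤ _ (n≤1+n _))
    ... | no _ | no _ | no _ | ih = ih

    #-unique : (P? : Decidable P) → Unique xs → (∀ {x y} → P x → P y → x ≡ y) → # P? xs ≤ 1
    #-unique P? [] _ = z≤n
    #-unique {xs = x ∷ xs} P? (x∉ ∷ u) fun with P? x
    ... | no _ = #-unique P? u fun
    ... | yes p = s≤s (#-none P? λ y∈ py → All.lookup x∉ y∈ (fun p py))

  -- Sums of such counts can be evaluated region by region along any partition of the vertex set.
  record Additive {A : Set} (κ : List A → ℕ) : Set where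
    field
      ++-hom : ∀ xs ys → κ (xs ++ ys) ≡ κ xs + κ ys
      ↭-inv : ∀ {xs ys} → xs ↭ ys → κ xs ≡ κ ys

  #-additive : (P? : Decidable P) → Additive (# P?)
  #-additive P? = record { ++-hom = #-++ P? ; ↭-inv = #-↭ P? }

  length-additive : Additive (length {A = A})
  length-additive = record { ++-hom = λ xs ys → length-++ xs ; ↭-inv = ↭-length }

  +-interchange : ∀ a b c d → a + b + (c + d) ≡ a + c + (b + d)
  +-interchange = solve-∀

  _+ᵃ_ : {κ λ′ : List A → ℕ} → Additive κ → Additive λ′ → Additive (λ xs → κ xs + λ′ xs)
  _+ᵃ_ {κ = κ} {λ′} α β = record
    { ++-hom = λ xs ys → trans (cong₂ _+_ (α.++-hom xs ys) (β.++-hom xs ys))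
        (+-interchange (κ xs) (κ ys) (λ′ xs) (λ′ ys))
    ; ↭-inv = λ p → cong₂ _+_ (α.↭-inv p) (β.↭-inv p) }
    where
    module α = Additive α
    module β = Additive β

  unique-++ʳ : ∀ (xs : List A) {ys} → Unique (xs ++ ys) → Unique ys
  unique-++ʳ [] u = u
  unique-++ʳ (x ∷ xs) (_ ∷ u) = unique-++ʳ xs u

  unique⇒≢ : ∀ {u v : A} (xs : List A) {ys} → Unique (xs ++ ys) → u ∈ xs → v ∈ ys → u ≢ v
  unique⇒≢ (x ∷ xs) (x∉ ∷ _) (here refl) v∈ = All.lookup x∉ (∈-++⁺ʳ xs v∈)
  unique⇒≢ (x ∷ xs) (_ ∷ u) (there u∈) v∈ = unique⇒≢ xs u u∈ v∈

  -- Pairs with a member in `B` are related by assumption, and all others keep their order.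
  allPairs-insert : {R : Rel A 0ℓ} (l B : List A) {r : List A} →
    (∀ {g} → g ∈ B → ∀ x → R x g × R g x) → AllPairs R (l ++ r) → AllPairs R (l ++ B ++ r)
  allPairs-insert [] [] _ ap = ap
  allPairs-insert [] (g ∷ B) triv ap =
    All.tabulate (λ {x} _ → proj₂ (triv (here refl) x)) ∷ allPairs-insert [] B (λ m → triv (there m)) ap
  allPairs-insert (x ∷ l) B triv (x~ ∷ ap) =
    All.++⁺ (All.++⁻ˡ l x~) (All.++⁺ (All.tabulate λ g∈ → proj₁ (triv g∈ x)) (All.++⁻ʳ l x~))
    ∷ allPairs-insert l B triv ap

  data Consecutive {A : Set} (P Q : Pred A 0ℓ) (xs : List A) : Set where
    at : ∀ l u v r → xs ≡ l ++ u ∷ v ∷ r → P u → Q v → Consecutive P Q xs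

  data TightGap {A : Set} (P Q : Pred A 0ℓ) (xs : List A) : Set where
    gap : ∀ l u B v r → xs ≡ l ++ u ∷ B ++ v ∷ r → P u → Q v →
      (∀ {x} → x ∈ B → ¬ P x × ¬ Q x) → TightGap P Q xs

  firstIn : (Q? : Decidable Q) (xs : List A) → (∀ {x} → x ∈ xs → ¬ Q x) ⊎
    ∃ λ B → ∃₂ λ v r → xs ≡ B ++ v ∷ r × Q v × (∀ {x} → x ∈ B → ¬ Q x)
  firstIn Q? [] = inj₁ λ ()
  firstIn Q? (x ∷ xs) with Q? x
  ... | yes q = inj₂ ([] , x , xs , refl , q , λ ())
  ... | no ¬q with firstIn Q? xs
  ...   | inj₁ none = inj₁ λ { (here refl) → ¬q ; (there m) → none m }
  ...   | inj₂ (B , v , r , refl , qv , none) =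
          inj₂ (x ∷ B , v , r , refl , qv , λ { (here refl) → ¬q ; (there m) → none m })

  allPairs-++ : {R : Rel A 0ℓ} (xs : List A) {ys : List A} → AllPairs R (xs ++ ys) →
    ∀ {u v} → u ∈ xs → v ∈ ys → R u v
  allPairs-++ (x ∷ xs) (x~ ∷ _) (here refl) v∈ = All.lookup x~ (∈-++⁺ʳ xs v∈)
  allPairs-++ (x ∷ xs) (_ ∷ ap) (there u∈) v∈ = allPairs-++ xs ap u∈ v∈

  allPairs-++ˡ : {R : Rel A 0ℓ} (xs : List A) {ys : List A} → AllPairs R (xs ++ ys) → AllPairs R xs
  allPairs-++ˡ [] _ = []
  allPairs-++ˡ (x ∷ xs) (x~ ∷ ap) = All.++⁻ˡ xs x~ ∷ allPairs-++ˡ xs ap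

  allPairs-++ʳ : {R : Rel A 0ℓ} (xs : List A) {ys : List A} → AllPairs R (xs ++ ys) → AllPairs R ys
  allPairs-++ʳ [] ap = ap
  allPairs-++ʳ (x ∷ xs) (_ ∷ ap) = allPairs-++ʳ xs ap

  -- Scan from the right. Once the tail has no `P` before a `Q`, the first `Q` after a head in `P`
  -- closes a gap; a `P` inside the gap would precede that `Q`.
  tightGap : (P? : Decidable P) (Q? : Decidable Q) (xs : List A) →
    AllPairs (λ u v → P u → ¬ Q v) xs ⊎ TightGap P Q xs
  tightGap P? Q? [] = inj₁ []
  tightGap P? Q? (x ∷ xs) with tightGap P? Q? xs
  ... | inj₂ (gap l u B v r refl pu qv far) = inj₂ (gap (x ∷ l) u B v r refl pu qv far)
  ... | inj₁ ap with P? x | firstIn Q? xs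
  ...   | no ¬p | _ = inj₁ (All.tabulate (λ _ p → ⊥-elim (¬p p)) ∷ ap)
  ...   | yes _ | inj₁ none = inj₁ (All.tabulate (λ m _ → none m) ∷ ap)
  ...   | yes p | inj₂ (B , v , r , refl , qv , none) =
          inj₂ (gap [] x B v r refl p qv λ m → (λ pb → allPairs-++ B ap m (here refl) pb qv) , none m)

  -- Walks, cycles and counting along a walk

  module Walks {A : Set} (_⟶_ : Rel A 0ℓ) where

    -- The list holds all vertices visited, both ends included. Repetitions are allowed here; they
    -- are excluded wherever the list is part of a permutation of the vertex set.
    data Walk : A → List A → A → Set where
      one : ∀ {x} → Walk x (x ∷ []) x
      _◂_ : ∀ {x y xs z} → x ⟶ y → Walk y xs z → Walk x (x ∷ xs) z

    infixr 5 _◂_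

    Cycle : List A → Set
    Cycle xs = ∃₂ λ s t → Walk s xs t × t ⟶ s

    private variable
      s t u v a b : A
      l r zs ws : List A

    start : Walk s (a ∷ zs) t → s ≡ a
    start one = refl
    start (_ ◂ _) = refl

    starting : Walk s zs t → ∃ λ l → zs ≡ s ∷ l
    starting one = _ , refl
    starting (_ ◂ _) = _ , refl

    first∈ : Walk s zs t → s ∈ zs
    first∈ one = here refl
    first∈ (_ ◂ _) = here refl

    last∈ : Walk s zs t → t ∈ zs
    last∈ one = here refl
    last∈ (_ ◂ w) = there (last∈ w)

    nonempty : Walk s zs t → 1 ≤ length zs
    nonempty one = s≤s z≤n
    nonempty (_ ◂ _) = s≤s z≤n

    join : Walk s zs t → t ⟶ u → Walk u ws v → Walk s (zs ++ ws) v
    join one e w = e ◂ w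
    join (e′ ◂ w′) e w = e′ ◂ join w′ e w

    cut : ∀ l → Walk s (l ++ a ∷ b ∷ r) t → Walk s (l ++ [ a ]) a × a ⟶ b × Walk b (b ∷ r) t
    cut [] (e ◂ w) with refl ← start w = one , e , w
    cut (_ ∷ []) (e ◂ w) with w₁ , e′ , w₂ ← cut [] w = e ◂ w₁ , e′ , w₂
    cut (_ ∷ l@(_ ∷ _)) (e ◂ w) with w₁ , e′ , w₂ ← cut l w = e ◂ w₁ , e′ , w₂

    cut′ : ∀ zs → 1 ≤ length zs → Walk s (zs ++ b ∷ r) t → ∃ λ a →
        Walk s zs a × a ⟶ b × Walk b (b ∷ r) t
    cut′ (_ ∷ []) _ (e ◂ w) with refl ← start w = _ , one , e , w
    cut′ (_ ∷ zs@(_ ∷ _)) _ (e ◂ w) with a , w₁ , e′ , w₂ ← cut′ zs (s≤s z≤n) w = a , e ◂ w₁ , e′ , w₂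

    -- A walk has at least one vertex, so the empty part before the start (and, in `After`, behind
    -- the end) needs a case of its own.
    data Before (s : A) : List A → A → Set where
      first : Before s [] s
      after : ∀ {x p l} → Walk s l p → p ⟶ x → Before s l x

    data After : A → List A → A → Set where
      final : After t [] t
      next : ∀ {x q r} → x ⟶ q → Walk q r t → After x r t

    reach : ∀ {x} → Walk s zs t → x ∈ zs →
      ∃₂ λ l r → zs ≡ l ++ x ∷ r × Before s l x × After x r t
    reach one (here refl) = [] , [] , refl , first , final
    reach (e ◂ w) (here refl) = [] , _ , refl , first , next e w
    reach (e ◂ w) (there m) with reach w m
    ... | l , r , refl , first , af = _ ∷ [] , r , refl , after one e , af
    ... | l , r , refl , after w′ e′ , af = _ ∷ l , r , refl , after (e ◂ w′) e′ , af

    from : ∀ {x} → After x r t → Walk x (x ∷ r) t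
    from final = one
    from (next e w) = e ◂ w

    upto : ∀ {x} → Before s l x → Walk s (l ++ [ x ]) x
    upto first = one
    upto (after w e) = join w e one

    unsnoc : Walk s zs t → (zs ≡ [ t ] × s ≡ t) ⊎ ∃₂ λ l p → zs ≡ l ++ [ t ] × Walk s l p × p ⟶ t
    unsnoc one = inj₁ (refl , refl)
    unsnoc (e ◂ w) with unsnoc w
    ... | inj₁ (refl , refl) = inj₂ (_ , _ , refl , one , e)
    ... | inj₂ (l , p , refl , w′ , e′) = inj₂ (_ , p , refl , e ◂ w′ , e′)

    private
      ends-eq : ∀ p q → 1 + (p + q) ≡ q + p + 1
      ends-eq = solve-∀
      step-eq₁ : ∀ p ps r rs q → 1 + (p + ps + (r + rs)) + q ≡ p + q + (1 + (ps + rs) + r)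
      step-eq₁ = solve-∀
      step-eq₂ : ∀ r q t k → 1 + (q + t + k + r) ≡ r + t + suc k + q
      step-eq₂ = solve-∀

      consecutive-arith : {P Q : Pred A 0ℓ} (P? : Decidable P) (Q? : Decidable Q) (x : A)
          (xs : List A) {q t k : ℕ} →
        # P? [ x ] + q ≤ 1 → 1 + (# P? xs + # Q? xs) ≤ q + t + k →
        1 + (# P? (x ∷ xs) + # Q? (x ∷ xs)) ≤ # Q? [ x ] + t + suc k
      consecutive-arith P? Q? x xs {q} {t} {k} pq ih
        rewrite #-++ P? [ x ] xs | #-++ Q? [ x ] xs =
        +-cancelʳ-≤ q _ _ (≤-trans (≤-reflexive (step-eq₁ (# P? [ x ]) (# P? xs) (# Q? [ x ])
            (# Q? xs) q))
          (≤-trans (pq ⊞ ih ⊞ ≤-refl {# Q? [ x ]}) (≤-reflexive (step-eq₂ (# Q? [ x ]) q t k))))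

    uncons : Walk s zs t → (zs ≡ [ s ] × s ≡ t) ⊎ ∃₂ λ x l → zs ≡ s ∷ l × s ⟶ x × Walk x l t
    uncons one = inj₁ (refl , refl)
    uncons (e ◂ w) = inj₂ (_ , _ , refl , e , w)

    -- Without such a neighbouring pair, each of the `length zs - 1` steps from `u` to `v` has at
    -- most one of `P u`, `Q v`. The sum over the steps omits only `P` at `t` and `Q` at `s`, which
    -- are added on the right.
    consecutive : {P Q : Pred A 0ℓ} (P? : Decidable P) (Q? : Decidable Q) → Walk s zs t →
      Consecutive P Q zs ⊎ 1 + (# P? zs + # Q? zs) ≤ # Q? [ s ] + # P? [ t ] + length zs
    consecutive P? Q? (one {x}) = inj₂ (≤-reflexive (ends-eq (# P? [ x ]) (# Q? [ x ])))
    consecutive {P = P} {Q} P? Q? (_◂_ {x} {y} {xs} {z} e w) with consecutive P? Q? w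
    ... | inj₁ (at l u v r refl pu qv) = inj₁ (at (x ∷ l) u v r refl pu qv)
    ... | inj₂ ih with #-both P? Q? x y
    ...   | inj₂ pq = inj₂ (consecutive-arith P? Q? x xs pq ih)
    ...   | inj₁ (p , q) = inj₁ (at [] x y _ (cong (x ∷_) (proj₂ (starting w))) p q)

open Lists

-- Arithmetic of the degree counts

module Arith where

  -- Each …-eq lemma compares the two sides of the sum of all hypotheses (some taken repeatedly).
  connected-arith-eq : ∀ s t n os ot is it →
    (s + t) + (n + ((1 + os) + (ot + (is + (1 + it))))) ≡
    suc 1 + (n + (((os + ot) + (is + it)) + (s + (0 + (0 + t)))))
  connected-arith-eq = solve-∀

  connected-arith : ∀ {s t n os ot is it} →
    s + t ≤ n →
    n ≤ (os + ot) + (is + it) →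
    1 + os ≤ s →
    ot ≤ 0 →
    is ≤ 0 →
    1 + it ≤ t →
    ⊥
  connected-arith {s} {t} {n} {os} {ot} {is} {it} h1 h2 h3 h4 h5 h6 =
    overfull 1 (h1 ⊞ h2 ⊞ h3 ⊞ h4 ⊞ h5 ⊞ h6) (connected-arith-eq s t n os ot is it)

  loosen-eq : ∀ a b x y l →
    (a + b) + ((x + y + l) + (1 + 1)) + 0 ≡
    (1 + l) + ((1 + (a + b)) + (x + y))
  loosen-eq = solve-∀

  loosen : ∀ a b l {x y} →
    1 + (a + b) ≤ x + y + l →
    x ≤ 1 →
    y ≤ 1 →
    a + b ≤ 1 + l
  loosen a b l {x} {y} h1 h2 h3 =
    derive 0 (h1 ⊞ h2 ⊞ h3) (loosen-eq a b x y l)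

  tighten-cyclic-eq : ∀ a b x y l →
    (a + b) + ((x + y + l) + 1) + 0 ≡
    l + ((1 + (a + b)) + (x + y))
  tighten-cyclic-eq = solve-∀

  tighten-cyclic : ∀ a b x y l →
    1 + (a + b) ≤ x + y + l →
    x + y ≤ 1 →
    a + b ≤ l
  tighten-cyclic a b x y l h1 h2 =
    derive 0 (h1 ⊞ h2) (tighten-cyclic-eq a b x y l)

  core-Q-eq : ∀ d a q b c →
    ((a + b) + (c + d)) + ((1 + q) + (1 + q)) + 0 ≡
    ((1 + q) + (1 + q)) + ((d + a) + (b + c))
  core-Q-eq = solve-∀

  core-Q : ∀ a b c d q →
    d + a ≤ 1 + q →
    b + c ≤ 1 + q →
    (a + b) + (c + d) ≤ (1 + q) + (1 + q)
  core-Q a b c d q h1 h2 =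
    derive 0 (h1 ⊞ h2) (core-Q-eq d a q b c)

  core-G-eq : ∀ a b g c d →
    (2 + ((a + b) + (c + d))) + (0 + (g + (g + 0))) + 0 ≡
    (g + g) + (a + ((1 + b) + ((1 + c) + d)))
  core-G-eq = solve-∀

  core-G : ∀ a b c d {g} →
    a ≤ 0 →
    1 + b ≤ g →
    1 + c ≤ g →
    d ≤ 0 →
    2 + ((a + b) + (c + d)) ≤ g + g
  core-G a b c d {g} h1 h2 h3 h4 =
    derive 0 (h1 ⊞ h2 ⊞ h3 ⊞ h4) (core-G-eq a b g c d)

  core-P-eq : ∀ a p b c d →
    (2 + ((a + b) + (c + d))) + (p + (0 + (0 + p))) + 0 ≡
    (p + p) + ((1 + a) + (b + (c + (1 + d))))
  core-P-eq = solve-∀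

  core-P : ∀ a b c d {p} →
    1 + a ≤ p →
    b ≤ 0 →
    c ≤ 0 →
    1 + d ≤ p →
    2 + ((a + b) + (c + d)) ≤ p + p
  core-P a b c d {p} h1 h2 h3 h4 =
    derive 0 (h1 ⊞ h2 ⊞ h3 ⊞ h4) (core-P-eq a p b c d)

  core-H-eq : ∀ a b h c d →
    ((a + b) + (c + d)) + (h + h) + 0 ≡
    (h + h) + ((a + b) + (c + d))
  core-H-eq = solve-∀

  core-H : ∀ a b c d {h} →
    a + b ≤ h →
    c + d ≤ h →
    (a + b) + (c + d) ≤ h + h
  core-H a b c d {h} h1 h2 =
    derive 0 (h1 ⊞ h2) (core-H-eq a b h c d)

  core-arith-eq : ∀ q g p h n κq κg κp κh →
    (q + (g + (p + h))) + ((q + (g + (p + h))) + ((n + n) + (κq + ((2 + κg) + ((2 + κp)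
      + κh))))) ≡
    suc 1 + (n + (n + ((κq + (κg + (κp + κh))) + (((1 + q) + (1 + q)) + ((g + g) + ((p + p)
      + (h + h)))))))
  core-arith-eq = solve-∀

  core-arith : ∀ n q g p h κq κg κp κh →
    q + (g + (p + h)) ≤ n →
    n + n ≤ κq + (κg + (κp + κh)) →
    κq ≤ (1 + q) + (1 + q) →
    2 + κg ≤ g + g →
    2 + κp ≤ p + p →
    κh ≤ h + h →
    ⊥
  core-arith n q g p h κq κg κp κh h1 h2 h3 h4 h5 h6 =
    overfull 1 (h1 ⊞ h1 ⊞ h2 ⊞ h3 ⊞ h4 ⊞ h5 ⊞ h6) (core-arith-eq q g p h n κq κg κp κh)

  swap-Q-eq : ∀ dq dg aq ag q g bq cq bg cg →
    (((aq + bq) + (cq + dq)) + ((ag + bg) + (cg + dg))) + ((1 + (q + g)) + ((1 + q) + (0 + 0)))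
      + 0 ≡
    ((1 + (q + g)) + (1 + q)) + (((dq + dg) + (aq + ag)) + ((bq + cq) + (bg + cg)))
  swap-Q-eq = solve-∀

  swap-Q : ∀ aq bq cq dq ag dg q g {bg cg} →
    (dq + dg) + (aq + ag) ≤ 1 + (q + g) →
    bq + cq ≤ 1 + q →
    bg ≤ 0 →
    cg ≤ 0 →
    ((aq + bq) + (cq + dq)) + ((ag + bg) + (cg + dg)) ≤ (1 + (q + g)) + (1 + q)
  swap-Q aq bq cq dq ag dg q g {bg} {cg} h1 h2 h3 h4 =
    derive 0 (h1 ⊞ h2 ⊞ h3 ⊞ h4) (swap-Q-eq dq dg aq ag q g bq cq bg cg)

  swap-X-eq : ∀ a b c d →
    ((a + b) + (c + d)) + (2 + (0 + (0 + 2))) + 0 ≡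
    2 + ((1 + a) + (b + (c + (1 + d))))
  swap-X-eq = solve-∀

  swap-X : ∀ a b c d →
    1 + a ≤ 2 →
    b ≤ 0 →
    c ≤ 0 →
    1 + d ≤ 2 →
    (a + b) + (c + d) ≤ 2
  swap-X a b c d h1 h2 h3 h4 =
    derive 0 (h1 ⊞ h2 ⊞ h3 ⊞ h4) (swap-X-eq a b c d)

  swap-P-eq : ∀ a b p c d →
    (2 + ((a + b) + (c + d))) + (0 + (p + (p + 0))) + 0 ≡
    (p + p) + (a + ((1 + b) + ((1 + c) + d)))
  swap-P-eq = solve-∀

  swap-P : ∀ a b c d {p} →
    a ≤ 0 →
    1 + b ≤ p →
    1 + c ≤ p →
    d ≤ 0 →
    2 + ((a + b) + (c + d)) ≤ p + p
  swap-P a b c d {p} h1 h2 h3 h4 =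
    derive 0 (h1 ⊞ h2 ⊞ h3 ⊞ h4) (swap-P-eq a b p c d)

  swap-arith-eq : ∀ q g p h n κq κg κx κp κh →
    (q + (g + (2 + (p + h)))) + ((q + (g + (2 + (p + h)))) + ((n + n) + ((κq + κg) + (κx + ((2
      + κp) + κh))))) ≡
    suc (1 + g) + (n + (n + ((κq + (κg + (κx + (κp + κh)))) + (((1 + (q + g)) + (1 + q)) + (2
      + ((p + p) + (h + h)))))))
  swap-arith-eq = solve-∀

  swap-arith : ∀ n q g p h κq κg κx κp κh →
    q + (g + (2 + (p + h))) ≤ n →
    n + n ≤ κq + (κg + (κx + (κp + κh))) →
    κq + κg ≤ (1 + (q + g)) + (1 + q) →
    κx ≤ 2 →
    2 + κp ≤ p + p →
    κh ≤ h + h →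
    ⊥
  swap-arith n q g p h κq κg κx κp κh h1 h2 h3 h4 h5 h6 =
    overfull (1 + g) (h1 ⊞ h1 ⊞ h2 ⊞ h3 ⊞ h4 ⊞ h5 ⊞ h6) (swap-arith-eq q g p h n κq κg κx κp κh)

  turn-Q-eq : ∀ yq yg aq ag q g dq dg xq xg bq cq bg cg →
    (((aq + bq) + ((cq + dq) + (xq + yq))) + ((ag + bg) + ((cg + dg) + (xg + yg)))) + ((1 + (q
      + g)) + ((1 + (q + g)) + ((1 + q) + (0 + 0)))) + 0 ≡
    ((1 + (q + g)) + (1 + (q + g)) + (1 + q)) + (((yq + yg) + (aq + ag)) + (((dq + dg) + (xq
      + xg)) + ((bq + cq) + (bg + cg))))
  turn-Q-eq = solve-∀

  turn-Q : ∀ aq bq cq dq xq yq ag dg xg yg q g {bg cg} →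
    (yq + yg) + (aq + ag) ≤ 1 + (q + g) →
    (dq + dg) + (xq + xg) ≤ 1 + (q + g) →
    bq + cq ≤ 1 + q →
    bg ≤ 0 →
    cg ≤ 0 →
    ((aq + bq) + ((cq + dq) + (xq + yq))) + ((ag + bg) + ((cg + dg) + (xg + yg))) ≤ (1 + (q + g))
      + (1 + (q + g)) + (1 + q)
  turn-Q aq bq cq dq xq yq ag dg xg yg q g {bg} {cg} h1 h2 h3 h4 h5 =
    derive 0 (h1 ⊞ h2 ⊞ h3 ⊞ h4 ⊞ h5) (turn-Q-eq yq yg aq ag q g dq dg xq xg bq cq bg cg)

  turn-X-eq : ∀ a b c d x y →
    ((a + b) + ((c + d) + (x + y))) + (2 + (0 + (0 + (2 + (0 + 0))))) + 0 ≡
    2 + ((1 + a) + (b + (c + ((1 + d) + (x + y)))))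
  turn-X-eq = solve-∀

  turn-X : ∀ a b c d x y →
    1 + a ≤ 2 →
    b ≤ 0 →
    c ≤ 0 →
    1 + d ≤ 2 →
    x ≤ 0 →
    y ≤ 0 →
    (a + b) + ((c + d) + (x + y)) ≤ 2
  turn-X a b c d x y h1 h2 h3 h4 h5 h6 =
    derive 0 (h1 ⊞ h2 ⊞ h3 ⊞ h4 ⊞ h5 ⊞ h6) (turn-X-eq a b c d x y)

  turn-P-eq : ∀ a b p c d x y →
    (2 + ((a + b) + ((c + d) + (x + y)))) + (0 + (p + (p + (0 + (0 + 0))))) + 0 ≡
    (p + p) + (a + ((1 + b) + ((1 + c) + (d + (x + y)))))
  turn-P-eq = solve-∀

  turn-P : ∀ a b c d x y {p} →
    a ≤ 0 →
    1 + b ≤ p →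
    1 + c ≤ p →
    d ≤ 0 →
    x ≤ 0 →
    y ≤ 0 →
    2 + ((a + b) + ((c + d) + (x + y))) ≤ p + p
  turn-P a b c d x y {p} h1 h2 h3 h4 h5 h6 =
    derive 0 (h1 ⊞ h2 ⊞ h3 ⊞ h4 ⊞ h5 ⊞ h6) (turn-P-eq a b p c d x y)

  turn-H-eq : ∀ c y h x b a d →
    ((a + b) + ((c + d) + (x + y))) + (h + (h + h)) + 0 ≡
    (h + (h + h)) + ((c + y) + ((x + b) + (a + d)))
  turn-H-eq = solve-∀

  turn-H : ∀ a b c d x y {h} →
    c + y ≤ h →
    x + b ≤ h →
    a + d ≤ h →
    (a + b) + ((c + d) + (x + y)) ≤ h + (h + h)
  turn-H a b c d x y {h} h1 h2 h3 =
    derive 0 (h1 ⊞ h2 ⊞ h3) (turn-H-eq c y h x b a d)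

  turn-arith-eq : ∀ q g p h n κq κg κx κp κh →
    (q + (g + (2 + (p + h)))) + ((q + (g + (2 + (p + h)))) + ((q + (g + (2 + (p + h)))) + ((n
      + (n + n)) + ((κq + κg) + (κx + ((2 + κp) + κh)))))) ≡
    suc (2 + (g + p)) + (n + (n + (n + ((κq + (κg + (κx + (κp + κh)))) + (((1 + (q + g)) + (1
      + (q + g)) + (1 + q)) + (2 + ((p + p) + ((h + (h + h))))))))))
  turn-arith-eq = solve-∀

  -- Three pairs are counted, and the regions allow at most `3n - (g + p + 3)`.
  turn-arith : ∀ n q g p h κq κg κx κp κh →
    q + (g + (2 + (p + h))) ≤ n →
    n + (n + n) ≤ κq + (κg + (κx + (κp + κh))) →
    κq + κg ≤ (1 + (q + g)) + (1 + (q + g)) + (1 + q) →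
    κx ≤ 2 →
    2 + κp ≤ p + p →
    κh ≤ h + (h + h) →
    ⊥
  turn-arith n q g p h κq κg κx κp κh h1 h2 h3 h4 h5 h6 =
    overfull (2 + (g + p)) (h1 ⊞ h1 ⊞ h1 ⊞ h2 ⊞ h3 ⊞ h4 ⊞ h5 ⊞ h6)
      (turn-arith-eq q g p h n κq κg κx κp κh)

  drop-middle-eq : ∀ n xC xs xH yC ys yH k →
    n + (((xC + (xs + xH)) + (yC + (ys + yH))) + k) + 0 ≡
    ((xC + xH) + (yC + yH) + k) + (n + (xs + ys))
  drop-middle-eq = solve-∀

  drop-middle : ∀ n k xC xs xH yC ys yH →
    n ≤ (xC + (xs + xH)) + (yC + (ys + yH)) →
    xs + ys ≤ k →
    n ≤ (xC + xH) + (yC + yH) + k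
  drop-middle n k xC xs xH yC ys yH h1 h2 =
    derive 0 (h1 ⊞ h2) (drop-middle-eq n xC xs xH yC ys yH k)

  kill-arith-eq : ∀ c₁ h n c₂ xC xH yC yH oC oH aC aH →
    (c₁ + (1 + h)) + ((c₂ + (1 + h)) + (n + (n + ((1 + (xH + yH)) + ((oH + aH) + ((aC + xC)
      + (yC + oC))))))) ≡
    suc 1 + (n + (n + (((xC + xH) + (yC + yH) + 1) + (((oC + oH) + (aC + aH) + 0) + (h + (h
      + (c₁ + c₂)))))))
  kill-arith-eq = solve-∀

  -- The bounds leave `2n ≤ c₁ + c₂ + 2h`; each cycle misses `h + 1` vertices, so the right side is
  -- at most `2n - 2`.
  kill-arith : ∀ n c₁ c₂ h xC xH yC yH oC oH aC aH →
    c₁ + (1 + h) ≤ n →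
    c₂ + (1 + h) ≤ n →
    n ≤ (xC + xH) + (yC + yH) + 1 →
    n ≤ (oC + oH) + (aC + aH) + 0 →
    1 + (xH + yH) ≤ h →
    oH + aH ≤ h →
    aC + xC ≤ c₁ →
    yC + oC ≤ c₂ →
    ⊥
  kill-arith n c₁ c₂ h xC xH yC yH oC oH aC aH h1 h2 h3 h4 h5 h6 h7 h8 =
    overfull 1 (h1 ⊞ h2 ⊞ h3 ⊞ h4 ⊞ h5 ⊞ h6 ⊞ h7 ⊞ h8)
      (kill-arith-eq c₁ h n c₂ xC xH yC yH oC oH aC aH)

  degree-own-eq : ∀ iC oC c os is oH iH k →
    ((oC + (os + oH)) + (iC + (is + iH))) + (c + (0 + (0 + k))) + 0 ≡
    (c + k) + ((iC + oC) + (os + (is + (oH + iH))))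
  degree-own-eq = solve-∀

  degree-own : ∀ c k oC os oH iC is iH →
    iC + oC ≤ c →
    os ≤ 0 →
    is ≤ 0 →
    oH + iH ≤ k →
    (oC + (os + oH)) + (iC + (is + iH)) ≤ c + k
  degree-own c k oC os oH iC is iH h1 h2 h3 h4 =
    derive 0 (h1 ⊞ h2 ⊞ h3 ⊞ h4) (degree-own-eq iC oC c os is oH iH k)

  degree-other-eq : ∀ iC oC c os is oH h iH →
    (1 + ((oC + (os + oH)) + (iC + (is + iH)))) + (c + (1 + (0 + (h + h)))) + 0 ≡
    (c + (h + h)) + ((iC + oC) + (os + (is + ((1 + oH) + (1 + iH)))))
  degree-other-eq = solve-∀

  degree-other : ∀ c h oC os oH iC is iH →
    iC + oC ≤ c →
    os ≤ 1 →
    is ≤ 0 →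
    1 + oH ≤ h →
    1 + iH ≤ h →
    1 + ((oC + (os + oH)) + (iC + (is + iH))) ≤ c + (h + h)
  degree-other c h oC os oH iC is iH h1 h2 h3 h4 h5 =
    derive 0 (h1 ⊞ h2 ⊞ h3 ⊞ h4 ⊞ h5) (degree-other-eq iC oC c os is oH h iH)

  kill-arith′-eq : ∀ c₁ h n c₂ oα iw ow iβ oβ iα a b →
    (c₁ + (1 + h)) + ((c₁ + (1 + h)) + ((c₂ + (1 + h)) + (n + (n + (n + ((oα + iα) + ((oβ + iβ)
      + ((1 + (ow + iw)) + (b + a))))))))) ≡
    suc 3 + (n + (n + (n + ((oα + iw) + ((ow + iβ) + ((oβ + iα) + ((c₁ + a) + ((c₂ + b) + ((c₁
      + (h + h)) + h)))))))))
  kill-arith′-eq = solve-∀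

  -- The bounds leave `3n ≤ 2c₁ + c₂ + 3h - 1`, and the right side is at most `3n - 4`.
  kill-arith′ : ∀ n c₁ c₂ h oα iα oβ iβ ow iw a b →
    c₁ + (1 + h) ≤ n →
    c₂ + (1 + h) ≤ n →
    n ≤ oα + iw →
    n ≤ ow + iβ →
    n ≤ oβ + iα →
    oα + iα ≤ c₁ + a →
    oβ + iβ ≤ c₂ + b →
    1 + (ow + iw) ≤ c₁ + (h + h) →
    b + a ≤ h →
    ⊥
  kill-arith′ n c₁ c₂ h oα iα oβ iβ ow iw a b h1 h2 h3 h4 h5 h6 h7 h8 h9 =
    overfull 3 (h1 ⊞ h1 ⊞ h2 ⊞ h3 ⊞ h4 ⊞ h5 ⊞ h6 ⊞ h7 ⊞ h8 ⊞ h9)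
      (kill-arith′-eq c₁ h n c₂ oα iw ow iβ oβ iα a b)

  missing-arith-eq : ∀ iC oC c os is n →
    (1 + ((oC + os) + (iC + is))) + (c + (0 + (0 + n))) + 0 ≡
    n + ((iC + oC) + (os + (is + (c + 1))))
  missing-arith-eq = solve-∀

  missing-arith : ∀ n c oC os iC is →
    iC + oC ≤ c →
    os ≤ 0 →
    is ≤ 0 →
    c + 1 ≤ n →
    1 + ((oC + os) + (iC + is)) ≤ n
  missing-arith n c oC os iC is h1 h2 h3 h4 =
    derive 0 (h1 ⊞ h2 ⊞ h3 ⊞ h4) (missing-arith-eq iC oC c os is n)

  gap-p-eq : ∀ oA a oB g oX oD →
    (oA + (oB + (oD + oX))) + (a + (g + 2)) + 0 ≡
    (a + (g + oD)) + (oA + ((1 + oB) + (1 + oX)))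
  gap-p-eq = solve-∀

  gap-p : ∀ a g oA oB oD oX →
    oA ≤ a →
    1 + oB ≤ g →
    1 + oX ≤ 2 →
    oA + (oB + (oD + oX)) ≤ a + (g + oD)
  gap-p a g oA oB oD oX h1 h2 h3 =
    derive 0 (h1 ⊞ h2 ⊞ h3) (gap-p-eq oA a oB g oX oD)

  gap-y-eq : ∀ iA iB g iX iD →
    (iA + (iB + (iD + iX))) + (0 + (g + 0)) + 0 ≡
    (g + iD) + (iA + (iB + iX))
  gap-y-eq = solve-∀

  gap-y : ∀ g iA iB iD iX →
    iA ≤ 0 →
    iB ≤ g →
    iX ≤ 0 →
    iA + (iB + (iD + iX)) ≤ g + iD
  gap-y g iA iB iD iX h1 h2 h3 =
    derive 0 (h1 ⊞ h2 ⊞ h3) (gap-y-eq iA iB g iX iD)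

  gap-e-eq : ∀ i o d a oB iB os is →
    ((o + (oB + os)) + (i + (iB + is))) + ((1 + (d + (1 + a))) + (0 + (0 + (0 + 0)))) + 0 ≡
    (2 + (d + a)) + ((i + o) + (oB + (iB + (os + is))))
  gap-e-eq = solve-∀

  gap-e : ∀ d a o oB os i iB is →
    i + o ≤ 1 + (d + (1 + a)) →
    oB ≤ 0 →
    iB ≤ 0 →
    os ≤ 0 →
    is ≤ 0 →
    (o + (oB + os)) + (i + (iB + is)) ≤ 2 + (d + a)
  gap-e d a o oB os i iB is h1 h2 h3 h4 h5 =
    derive 0 (h1 ⊞ h2 ⊞ h3 ⊞ h4 ⊞ h5) (gap-e-eq i o d a oB iB os is)

  gap-arith₁-eq : ∀ n oy ix ox ie oe iy →
    n + (n + (n + ((1 + (ox + ix)) + ((1 + (oe + ie)) + ((1 + (oy + iy))))))) ≡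
    suc 2 + ((oy + ix) + ((ox + ie) + ((oe + iy) + (n + (n + n)))))
  gap-arith₁-eq = solve-∀

  gap-arith₁ : ∀ n ox ix oe ie oy iy →
    n ≤ oy + ix →
    n ≤ ox + ie →
    n ≤ oe + iy →
    1 + (ox + ix) ≤ n →
    1 + (oe + ie) ≤ n →
    1 + (oy + iy) ≤ n →
    ⊥
  gap-arith₁ n ox ix oe ie oy iy h1 h2 h3 h4 h5 h6 =
    overfull 2 (h1 ⊞ h2 ⊞ h3 ⊞ h4 ⊞ h5 ⊞ h6) (gap-arith₁-eq n oy ix ox ie oe iy)

  gap-arith₂-eq : ∀ a g d n op ie oe iy yD pD →
    (a + (g + (d + 2))) + ((a + (g + (d + 2))) + (n + (n + (iy + (op + ((yD + pD) + (oe
      + ie))))))) ≡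
    suc 0 + (n + (n + ((op + ie) + ((oe + iy) + ((g + yD) + ((a + (g + pD)) + ((1 + d) + ((2
      + (d + a))))))))))
  gap-arith₂-eq = solve-∀

  -- The bounds add up to `2n ≤ 2(a + g + d) + 3`, and the right side is at most `2n - 1`.
  gap-arith₂ : ∀ n a g d op ie oe iy yD pD →
    a + (g + (d + 2)) ≤ n →
    n ≤ op + ie →
    n ≤ oe + iy →
    iy ≤ g + yD →
    op ≤ a + (g + pD) →
    yD + pD ≤ 1 + d →
    oe + ie ≤ 2 + (d + a) →
    ⊥
  gap-arith₂ n a g d op ie oe iy yD pD h1 h2 h3 h4 h5 h6 h7 =
    overfull 0 (h1 ⊞ h1 ⊞ h2 ⊞ h3 ⊞ h4 ⊞ h5 ⊞ h6 ⊞ h7) (gap-arith₂-eq a g d n op ie oe iy yD pD)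

  cross-arith-eq : ∀ iy oe q n ox ix →
    (iy + oe) + (n + (ox + (ix + (q + 2)))) ≡
    suc 0 + ((1 + q) + (((oe + ox) + (iy + ix)) + (0 + (0 + n))))
  cross-arith-eq = solve-∀

  cross-arith : ∀ n q oe ox iy ix →
    iy + oe ≤ 1 + q →
    n ≤ (oe + ox) + (iy + ix) →
    ox ≤ 0 →
    ix ≤ 0 →
    q + 2 ≤ n →
    ⊥
  cross-arith n q oe ox iy ix h1 h2 h3 h4 h5 =
    overfull 0 (h1 ⊞ h2 ⊞ h3 ⊞ h4 ⊞ h5) (cross-arith-eq iy oe q n ox ix)

  final-U-eq : ∀ iy oy u iv oe ou ie →
    (1 + ((oy + iv) + ((ou + ie) + (oe + iy)))) + ((1 + u) + ((1 + u) + (u + 0))) + 0 ≡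
    ((1 + u) + ((1 + u) + u)) + ((iy + oy) + ((iv + oe) + ((1 + ou) + ie)))
  final-U-eq = solve-∀

  final-U : ∀ u oy iv ou ie oe iy →
    iy + oy ≤ 1 + u →
    iv + oe ≤ 1 + u →
    1 + ou ≤ u →
    ie ≤ 0 →
    1 + ((oy + iv) + ((ou + ie) + (oe + iy))) ≤ (1 + u) + ((1 + u) + u)
  final-U u oy iv ou ie oe iy h1 h2 h3 h4 =
    derive 0 (h1 ⊞ h2 ⊞ h3 ⊞ h4) (final-U-eq iy oy u iv oe ou ie)

  final-W-eq : ∀ iy ou w ie oe iv oy →
    (1 + ((oy + iv) + ((ou + ie) + (oe + iy)))) + ((1 + w) + ((1 + w) + (w + 0))) + 0 ≡
    ((1 + w) + ((1 + w) + w)) + ((iy + ou) + ((ie + oe) + ((1 + iv) + oy)))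
  final-W-eq = solve-∀

  final-W : ∀ w oy iv ou ie oe iy →
    iy + ou ≤ 1 + w →
    ie + oe ≤ 1 + w →
    1 + iv ≤ w →
    oy ≤ 0 →
    1 + ((oy + iv) + ((ou + ie) + (oe + iy))) ≤ (1 + w) + ((1 + w) + w)
  final-W w oy iv ou ie oe iy h1 h2 h3 h4 =
    derive 0 (h1 ⊞ h2 ⊞ h3 ⊞ h4) (final-W-eq iy ou w ie oe iv oy)

  final-X-eq : ∀ oy iv ou ie oe iy →
    ((oy + iv) + ((ou + ie) + (oe + iy))) + (0 + (1 + (1 + (0 + (0 + 0))))) + 0 ≡
    2 + (oy + (iv + (ou + (ie + (oe + iy)))))
  final-X-eq = solve-∀

  final-X : ∀ oy iv ou ie oe iy →
    oy ≤ 0 →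
    iv ≤ 1 →
    ou ≤ 1 →
    ie ≤ 0 →
    oe ≤ 0 →
    iy ≤ 0 →
    (oy + iv) + ((ou + ie) + (oe + iy)) ≤ 2
  final-X oy iv ou ie oe iy h1 h2 h3 h4 h5 h6 =
    derive 0 (h1 ⊞ h2 ⊞ h3 ⊞ h4 ⊞ h5 ⊞ h6) (final-X-eq oy iv ou ie oe iy)

  final-arith-eq : ∀ u w n κU κW κX →
    (u + (w + 2)) + ((u + (w + 2)) + ((u + (w + 2)) + ((n + (n + n)) + ((1 + κU) + ((1 + κW)
      + κX))))) ≡
    suc 1 + (n + (n + (n + ((κU + (κW + κX)) + (((1 + u) + ((1 + u) + u)) + (((1 + w) + ((1
      + w) + w)) + 2))))))
  final-arith-eq = solve-∀

  final-arith : ∀ n u w κU κW κX →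
    u + (w + 2) ≤ n →
    n + (n + n) ≤ κU + (κW + κX) →
    1 + κU ≤ (1 + u) + ((1 + u) + u) →
    1 + κW ≤ (1 + w) + ((1 + w) + w) →
    κX ≤ 2 →
    ⊥
  final-arith n u w κU κW κX h1 h2 h3 h4 h5 =
    overfull 1 (h1 ⊞ h1 ⊞ h1 ⊞ h2 ⊞ h3 ⊞ h4 ⊞ h5) (final-arith-eq u w n κU κW κX)

-- The Hamiltonicity theorem with exceptional pairs

module Ore {n : ℕ} (_⟶_ : Rel (Fin n) 0ℓ) (_⟶?_ : Decidable₂ _⟶_) (loopless : ∀ {u} → ¬ u ⟶ u)
  (M : Rel (Fin n) 0ℓ) (M? : Decidable₂ M)
  (M-functional : ∀ {u v w} → M u v → M u w → v ≡ w)
  (M-injective : ∀ {u v w} → M u w → M v w → u ≡ v)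
  (M-asym : ∀ {u v} → M u v → ¬ M v u)
  (heavy : ∀ {u v} → u ≢ v → ¬ u ⟶ v → ¬ M u v →
    n ≤ # (u ⟶?_) (allFin n) + # (_⟶? v) (allFin n))
  (n>2 : 2 < n)
  where

  open Walks _⟶_
  open Arith
  open import Algebra.Solver.CommutativeMonoid (++-commutativeMonoid {A =
      Fin n}) using (solve; _⊕_; _⊜_)

  V : List (Fin n)
  V = allFin n

  Vertices : Set
  Vertices = List (Fin n)

  outTo : Fin n → Vertices → ℕ
  outTo u = # (u ⟶?_)

  inFrom : Fin n → Vertices → ℕ
  inFrom v = # (_⟶? v)

  outTo-additive : ∀ u → Additive (outTo u)
  outTo-additive u = #-additive (u ⟶?_)

  inFrom-additive : ∀ v → Additive (inFrom v)
  inFrom-additive v = #-additive (_⟶? v)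

  ∣V∣ : length V ≡ n
  ∣V∣ = length-tabulate _

  cover-unique : ∀ {xs} → xs ↭ V → Unique xs
  cover-unique p = PermS.Unique-resp-↭ (setoid (Fin n)) (↭⇒↭ₛ (↭-sym p)) (allFin⁺ n)

  module _ {κ : Vertices → ℕ} (α : Additive κ) where
    open Additive α

    split₂ : ∀ xs ys → xs ++ ys ↭ V → κ V ≡ κ xs + κ ys
    split₂ xs ys p = trans (sym (↭-inv p)) (++-hom xs ys)

    split₄ : ∀ ws xs ys zs → ws ++ xs ++ ys ++ zs ↭ V → κ V ≡ κ ws + (κ xs + (κ ys + κ zs))
    split₄ ws xs ys zs p = trans (split₂ ws _ p)
      (cong (κ ws +_) (trans (++-hom xs _) (cong (κ xs +_) (++-hom ys zs))))

    split₅ : ∀ vs ws xs ys zs → vs ++ ws ++ xs ++ ys ++ zs ↭ V →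
      κ V ≡ κ vs + (κ ws + (κ xs + (κ ys + κ zs)))
    split₅ vs ws xs ys zs p = trans (split₂ vs _ p)
      (cong (κ vs +_) (trans (++-hom ws _)
          (cong (κ ws +_) (trans (++-hom xs _) (cong (κ xs +_) (++-hom ys zs))))))

  -- Strong connectivity and excursions

  findArc : ∀ S T → (∃₂ λ s t → s ∈ S × t ∈ T × s ⟶ t) ⊎ (∀ {s t} → s ∈ S → t ∈ T → ¬ s ⟶ t)
  findArc S T with any? (λ s → any? (s ⟶?_) T) S
  ... | yes p with s , s∈ , q ← find p with t , t∈ , e ← find q = inj₁ (s , t , s∈ , t∈ , e)
  ... | no ¬p = inj₂ λ s∈ t∈ e → ¬p (Any.map (λ { refl → Any.map (λ { refl → e }) t∈ }) s∈)

  -- `M` links a vertex to at most one other in each direction; since `n > 2`, one side has a second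
  -- vertex to switch to.
  unexceptional : ∀ S T → S ++ T ↭ V → 1 ≤ length S → 1 ≤ length T →
    ∃₂ λ s t → s ∈ S × t ∈ T × ¬ M s t
  unexceptional (s ∷ S) (t ∷ T) cover _ _ with M? s t
  ... | no ¬m = s , t , here refl , here refl , ¬m
  unexceptional (s ∷ s′ ∷ S) (t ∷ T) cover _ _ | yes m with cover-unique cover
  ... | s∉ ∷ _ = s′ , t , there (here refl) , here refl ,
    λ m′ → All.lookup s∉ (here refl) (M-injective m m′)
  unexceptional (s ∷ []) (t ∷ t′ ∷ T) cover _ _ | yes m with cover-unique cover
  ... | _ ∷ t∉ ∷ _ = s , t′ , here refl , there (here refl) ,
    λ m′ → All.lookup t∉ (here refl) (M-functional m m′)
  unexceptional (s ∷ []) (t ∷ []) cover _ _ | yes m =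
    ⊥-elim (<⇒≢ n>2 (trans (↭-length cover) ∣V∣))

  -- Without such an arc, an unexceptional pair has `d⁺(s) < |S|` and `d⁻(t) < |T|`, so its degree
  -- sum is at most `n - 2`.
  connected : ∀ S T → S ++ T ↭ V → 1 ≤ length S → 1 ≤ length T →
    ∃₂ λ s t → s ∈ S × t ∈ T × s ⟶ t
  connected S T cover 1≤S 1≤T with findArc S T | unexceptional S T cover 1≤S 1≤T
  ... | inj₁ arc | _ = arc
  ... | inj₂ none | s , t , s∈ , t∈ , ¬m = ⊥-elim (connected-arith
    (≤-reflexive (trans (sym (split₂ length-additive S T cover)) ∣V∣))
    (≤-trans (heavy (unique⇒≢ S (cover-unique cover) s∈ t∈) (none s∈ t∈) ¬m)
      (≤-reflexive (cong₂ _+_ (split₂ (outTo-additive s) S T cover)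
          (split₂ (inFrom-additive t) S T cover))))
    (#<length (s ⟶?_) s∈ loopless) (#-none (s ⟶?_) (none s∈))
    (#-none (_⟶? t) λ x∈ → none x∈ t∈) (#<length (_⟶? t) t∈ loopless))

  -- An ear of `T` with interior in `R`; its ends `c` and `t` may coincide, and `others` is the rest
  -- of `R`.
  record Excursion (T R : Vertices) : Set where
    field
      {c p s t} : Fin n
      {path others} : Vertices
      c∈T : c ∈ T
      t∈T : t ∈ T
      c⟶p : c ⟶ p
      walk : Walk p path s
      s⟶t : s ⟶ t
      perm : path ++ others ↭ R

  excursion : ∀ T R → T ++ R ↭ V → 1 ≤ length T → 1 ≤ length R → Excursion T R
  excursion T R cover 1≤T 1≤R with connected T R cover 1≤T 1≤R
  ... | c , p , c∈T , p∈R , c⟶p with ∈-∃++ p∈R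
  ...   | l , r , refl = grow (length (l ++ r)) [ p ] (l ++ r) refl (↭-sym (shift p l r)) (s≤s z≤n)
            λ { (here refl) → [ p ] , [] , one , ↭-refl }
    where
    R′ : Vertices
    R′ = l ++ p ∷ r

    -- `S` consists of vertices reached from `p` inside `R′`, and `U` is the rest. An arc leaving
    -- `S` either returns to `T`, which completes the excursion, or moves a vertex from `U` to `S`.
    grow : ∀ k S U → length U ≡ k → S ++ U ↭ R′ → 1 ≤ length S →
      (∀ {s} → s ∈ S → ∃₂ λ ys zs → Walk p ys s × ys ++ zs ↭ S) → Excursion T R′
    grow k S U ∣U∣ S++U 1≤S reached with connected S (T ++ U)
      (↭-trans (solve 3 (λ s t u → s ⊕ (t ⊕ u) ⊜ t ⊕ (s ⊕ u)) ↭-refl S T U)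
          (↭-trans (++⁺ˡ T S++U) cover))
      1≤S (≤-trans (m≤n⇒m≤n+o (length U) 1≤T) (≤-reflexive (sym (length-++ T))))
    ... | s , t , s∈S , t∈ , s⟶t with reached s∈S | ∈-++⁻ T t∈
    ...   | ys , zs , walk , perm | inj₁ t∈T = record
      { c∈T = c∈T ; t∈T = t∈T ; c⟶p = c⟶p ; walk = walk ; s⟶t = s⟶t
      ; perm = ↭-trans (↭-reflexive (sym (++-assoc ys zs U))) (↭-trans (++⁺ʳ U perm) S++U) }
    ...   | ys , zs , walk , perm | inj₂ t∈U with k | ∈-∃++ t∈U
    ...     | zero | l , r , refl = ⊥-elim (0≢1+n (sym (trans (sym (↭-length (shift t l r))) ∣U∣)))
    ...     | suc k | l , r , refl = grow k (t ∷ S) (l ++ r)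
      (suc-injective (trans (sym (↭-length (shift t l r))) ∣U∣))
      (↭-trans (solve 4 (λ t s l r → t ⊕ (s ⊕ (l ⊕ r)) ⊜ s ⊕ (l ⊕ (t ⊕ r))) ↭-refl [ t ] S l r) S++U)
      (s≤s z≤n)
      λ { (here refl) → ys ++ [ t ] , zs , join walk s⟶t one ,
            ↭-trans (solve 3 (λ y t z → (y ⊕ t) ⊕ z ⊜ t ⊕ (y ⊕ z)) ↭-refl ys [ t ] zs) (++⁺ˡ [ t ] perm)
        ; (there s∈) → let ys , zs , w , p = reached s∈ in ys , t ∷ zs , w ,
            ↭-trans (solve 3 (λ y t z → y ⊕ (t ⊕ z) ⊜ t ⊕ (y ⊕ z)) ↭-refl ys [ t ] zs) (++⁺ˡ [ t ] p) }

  -- Longest cycles and ears with shortest `G`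

  Longest : ℕ → Set
  Longest h = ∀ {C R} → Cycle C → C ++ R ↭ V → h ≤ length R

  -- The contradiction for every spliced cycle: `C` has taken up the nonempty `ys` out of the missed
  -- vertices `W`.
  longer : ∀ ys R {C W} → Longest (length W) → Cycle C → C ++ R ↭ V → ys ++ R ↭ W → 1 ≤ length ys → ⊥
  longer ys R longest c cover perm 1≤ys = <⇒≱
    (≤-trans (+-monoˡ-≤ (length R) 1≤ys) (≤-reflexive (trans (sym (length-++ ys)) (↭-length perm))))
    (longest c cover)

  -- Q ++ G and Q ++ P close up to cycles; H is the rest of the vertices.
  record Ear (Q G P H : Vertices) : Set where
    field
      {b a e f p q} : Fin n
      walkQ : Walk b Q a
      walkG : Walk e G f
      walkP : Walk p P q
      a⟶e : a ⟶ e
      f⟶b : f ⟶ b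
      a⟶p : a ⟶ p
      q⟶b : q ⟶ b
      cover : Q ++ G ++ P ++ H ↭ V
      longest : Longest (length (P ++ H))

  -- What minimality of G gives: no path through P ++ H shortcuts G.
  record Tight {Q G P H} (ε : Ear Q G P H) : Set where
    open Ear ε
    field
      early : ∀ {ys zs y x} → Walk p ys y → y ⟶ x → x ∈ G → ys ++ zs ↭ P ++ H → ⊥
      late : ∀ {ys zs x y} → x ∈ G → x ⟶ y → Walk y ys q → ys ++ zs ↭ P ++ H → ⊥
      mid : ∀ {w} → w ∈ H → e ≢ f → e ⟶ w → ¬ w ⟶ f

  pick : ∀ {w} {H : Vertices} → w ∈ H → ∃ λ H′ → H ↭ w ∷ H′
  pick w∈ with l , r , refl ← ∈-∃++ w∈ = l ++ r , shift _ l r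

  module _ {Q G P H} (ε : Ear Q G P H)
    (minimal : ∀ {Q′ G′ P′ H′} → Ear Q′ G′ P′ H′ → P′ ++ H′ ↭ P ++ H → length G ≤ length G′) where
    private module E = Ear ε

    private
      recover : ∀ {W} → W ↭ P ++ H → Q ++ G ++ W ↭ V
      recover perm = ↭-trans (++⁺ˡ Q (++⁺ˡ G perm)) E.cover

      relongest : ∀ {W} → W ↭ P ++ H → Longest (length W)
      relongest perm = subst Longest (sym (↭-length perm)) E.longest

      shorter : ∀ {l x r} → G ≡ l ++ x ∷ r → length l < length G
      shorter {l} refl = ≤-trans (≤-reflexive (+-comm 1 (length l)))
        (≤-trans (+-monoʳ-≤ (length l) (s≤s z≤n)) (≤-reflexive (sym (length-++ l))))

      shorter′ : ∀ {l x r} → G ≡ l ++ x ∷ r → length r < length G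
      shorter′ {l} {x} {r} refl = ≤-trans (m≤n+m _ (length l)) (≤-reflexive (sym (length-++ l {x ∷ r})))

    -- If `x` starts `G`, then `Q`, `ys`, `G` form a longer cycle. Otherwise the part of `G` before
    -- `x` is a shorter gap, the remainder of `G` being put in front of `Q`.
    early′ : ∀ {ys zs y x} → Walk E.p ys y → y ⟶ x → x ∈ G → ys ++ zs ↭ P ++ H → ⊥
    early′ {ys} {zs} w e x∈ perm with reach E.walkG x∈
    ... | _ , r , eq , first , af = longer ys zs E.longest
      (_ , _ , join E.walkQ E.a⟶p (join w e E.walkG) , E.f⟶b)
      (↭-trans (solve 4 (λ q y g z → (q ⊕ (y ⊕ g)) ⊕ z ⊜ q ⊕ (g ⊕ (y ⊕ z))) ↭-refl Q ys G zs)
          (recover perm))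
      perm (nonempty w)
    ... | l , r , eq , after w′ e′ , af = <⇒≱ (shorter eq) (minimal record
      { walkQ = join (from af) E.f⟶b E.walkQ ; walkG = w′ ; walkP = w
      ; a⟶e = E.a⟶e ; f⟶b = e′ ; a⟶p = E.a⟶p ; q⟶b = e
      ; cover = ↭-trans (solve 5 (λ x q l y z → (x ⊕ q) ⊕ (l ⊕ (y ⊕ z)) ⊜ q ⊕ ((l ⊕ x) ⊕ (y ⊕ z)))
          ↭-refl (_ ∷ r) Q l ys zs)
          (subst (λ G → Q ++ G ++ ys ++ zs ↭ V) eq (recover perm))
      ; longest = relongest perm } perm)

    -- Mirror image of `early′`: the part of `G` after `x` is the shorter gap, unless it is empty.
    late′ : ∀ {ys zs x y} → x ∈ G → x ⟶ y → Walk y ys E.q → ys ++ zs ↭ P ++ H → ⊥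
    late′ {ys} {zs} x∈ e w perm with reach E.walkG x∈
    ... | l , _ , eq , bf , final = longer ys zs E.longest
      (_ , _ , join E.walkQ E.a⟶e (join E.walkG e w) , E.q⟶b)
      (↭-trans (solve 4 (λ q y g z → (q ⊕ (g ⊕ y)) ⊕ z ⊜ q ⊕ (g ⊕ (y ⊕ z))) ↭-refl Q ys G zs)
          (recover perm))
      perm (nonempty w)
    ... | l , r , eq , bf , next {x = x} e′ w′ = <⇒≱ (shorter′ {l} eq) (minimal record
      { walkQ = join E.walkQ E.a⟶e (upto bf) ; walkG = w′ ; walkP = w
      ; a⟶e = e′ ; f⟶b = E.f⟶b ; a⟶p = e ; q⟶b = E.q⟶b
      ; cover = ↭-trans (solve 6 (λ q l x r y z → (q ⊕ (l ⊕ x)) ⊕ (r ⊕ (y ⊕ z)) ⊜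
          q ⊕ ((l ⊕ (x ⊕ r)) ⊕ (y ⊕ z))) ↭-refl Q l [ x ] r ys zs)
          (subst (λ G → Q ++ G ++ ys ++ zs ↭ V) eq (recover perm))
      ; longest = relongest perm } perm)

    -- If `G` consists of `e` and `f`, then `w` fits between them. Otherwise the interior of `G` is
    -- a shorter gap, with `w` as the new path beside it.
    mid′ : ∀ {w} → w ∈ H → E.e ≢ E.f → E.e ⟶ w → ¬ w ⟶ E.f
    mid′ {w} w∈ e≢f e⟶w w⟶f with pick w∈ | unsnoc E.walkG
    ... | _ | inj₁ (_ , e≡f) = e≢f e≡f
    ... | H′ , H↭ | inj₂ (_ , _ , eq , one , _) = longer [ w ] (P ++ H′) E.longest
      (_ , _ , join E.walkQ E.a⟶e (e⟶w ◂ w⟶f ◂ one) , E.f⟶b)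
      (↭-trans (solve 6 (λ q e w f p h → (q ⊕ (e ⊕ (w ⊕ f))) ⊕ (p ⊕ h) ⊜ q ⊕ ((e ⊕ f) ⊕ (w ⊕ (p ⊕ h))))
          ↭-refl Q [ E.e ] [ w ] [ E.f ] P H′)
        (subst (λ G → Q ++ G ++ w ∷ P ++ H′ ↭ V) eq (recover perm)))
      perm (s≤s z≤n)
      where
      perm : [ w ] ++ P ++ H′ ↭ P ++ H
      perm = ↭-trans (↭-sym (shift w P H′)) (++⁺ˡ P (↭-sym H↭))
    ... | H′ , H↭ | inj₂ (_ , _ , eq , _◂_ {xs = l} e⟶g w′ , g⟶f) =
      <⇒≱ (≤-trans (s≤s (≤-trans (m≤m+n (length l) 1) (≤-reflexive (sym (length-++ l)))))
          (≤-reflexive (cong length (sym eq)))) (minimal record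
      { walkQ = join (one {E.f}) E.f⟶b (join E.walkQ E.a⟶e one) ; walkG = w′ ; walkP = one {w}
      ; a⟶e = e⟶g ; f⟶b = g⟶f ; a⟶p = e⟶w ; q⟶b = w⟶f
      ; cover = ↭-trans (solve 6 (λ f q e l w h → (f ⊕ (q ⊕ e)) ⊕ (l ⊕ (w ⊕ h)) ⊜
          q ⊕ ((e ⊕ (l ⊕ f)) ⊕ (w ⊕ h))) ↭-refl [ E.f ] Q [ E.e ] l [ w ] (P ++ H′))
          (subst (λ G → Q ++ G ++ w ∷ P ++ H′ ↭ V) eq (recover perm))
      ; longest = relongest perm } perm)
      where
      perm : [ w ] ++ P ++ H′ ↭ P ++ H
      perm = ↭-trans (↭-sym (shift w P H′)) (++⁺ˡ P (↭-sym H↭))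

    tight : Tight ε
    tight = record { early = early′ ; late = late′ ; mid = mid′ }

  -- Descent on the length of `G`, with the missed vertices `R` fixed.
  tighten : ∀ {R} → (∀ {Q G P H} (ε : Ear Q G P H) → P ++ H ↭ R → Tight ε → ⊥) →
    ∀ {Q G P H} → Ear Q G P H → P ++ H ↭ R → ⊥
  tighten {R} contra {G = G} ε perm = <-rec
    (λ g → ∀ {Q G P H} → Ear Q G P H → P ++ H ↭ R → length G ≡ g → ⊥)
    (λ { g rec ε perm refl → contra ε perm (tight ε λ ε′ perm′ →
      ≮⇒≥ λ lt → rec lt ε′ (↭-trans perm′ perm) refl) })
    (length G) ε perm refl

  -- Inserting paths into a path

  Far : Fin n → Vertices → Set
  Far z B = ∀ {g} → g ∈ B → ¬ g ⟶ z × ¬ z ⟶ g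

  -- The out-neighbours of `z` come first and its in-neighbours after them, with at most one vertex
  -- being both.
  Single : Fin n → Vertices → Set
  Single z = AllPairs (λ u v → u ⟶ z → ¬ z ⟶ v)

  -- The field `single` holds because vertices not adjacent to `z` do not disturb the order of its
  -- neighbours.
  record Inserted (s : Fin n) (xs : Vertices) (t : Fin n) (B : Vertices) : Set where
    field
      {list} : Vertices
      walk : Walk s list t
      perm : list ↭ xs ++ B
      single : ∀ {z} → Far z B → Single z xs → Single z list

  insertAt : ∀ {s xs t p B q} → Walk s xs t → Walk p B q → Consecutive (_⟶ p) (q ⟶_) xs →
      Inserted s xs t B
  insertAt {B = B} w w′ (at l u v r refl u⟶p q⟶v) with w₁ , _ , w₂ ← cut l w = record
    { walk = join w₁ u⟶p (join w′ q⟶v w₂)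
    ; perm = solve 4 (λ l u b r → (l ⊕ u) ⊕ (b ⊕ r) ⊜ (l ⊕ (u ⊕ r)) ⊕ b) ↭-refl l [ u ] B (v ∷ r)
    ; single = λ {z} far sg → allPairs-insert (l ++ [ u ]) B
        (λ g∈ _ → (λ _ → proj₂ (far g∈)) , λ e → ⊥-elim (proj₁ (far g∈) e))
        (subst (Single z) (sym (++-assoc l [ u ] (v ∷ r))) sg) }

  crossing : ∀ {P Q : Fin n → Set} (P? : Decidable P) (Q? : Decidable Q) {s xs t} → Walk s xs t →
    Consecutive P Q xs ⊎ # P? xs + # Q? xs ≤ 1 + length xs
  crossing P? Q? {s} {xs} {t} w with consecutive P? Q? w
  ... | inj₁ c = inj₁ c
  ... | inj₂ bound = inj₂ (loosen (# P? xs) (# Q? xs) (length xs) bound (#-single Q? s) (#-single P? t))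

  insert : ∀ {s xs t p B q} → Walk s xs t → Walk p B q →
    Inserted s xs t B ⊎ inFrom p xs + outTo q xs ≤ 1 + length xs
  insert {p = p} {q = q} w w′ with crossing (_⟶? p) (q ⟶?_) w
  ... | inj₁ c = inj₁ (insertAt w w′ c)
  ... | inj₂ bound = inj₂ bound

  idle : ∀ {s xs t} → Walk s xs t → Inserted s xs t []
  idle {xs = xs} w = record { walk = w ; perm = ↭-reflexive (sym (++-identityʳ xs)) ; single = λ _ sg →
      sg }

  compose : ∀ {s xs t B B′} (i : Inserted s xs t B) → Inserted s (Inserted.list i) t B′ →
      Inserted s xs t (B ++ B′)
  compose {xs = xs} {B = B} {B′} i j = record
    { walk = j.walk
    ; perm = ↭-trans j.perm (↭-trans (++⁺ʳ B′ i.perm) (↭-reflexive (++-assoc xs B B′)))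
    ; single = λ far sg → j.single (λ g∈ → far (∈-++⁺ʳ B g∈)) (i.single (λ g∈ → far (∈-++⁺ˡ g∈)) sg) }
    where
    module i = Inserted i
    module j = Inserted j

  -- Exchanging an end of `G` at a tight ear

  data Outcome {Q G P H} (ε : Ear Q G P H) : Set where
    dropFirst : ∀ {y Q′} → let open Ear ε in P ≡ [ y ] → M y e → a ⟶ y → y ⟶ b → Walk b Q′ a →
        Q′ ++ e ∷ y ∷ H ↭ V →
      (∀ {z} → Far z G → Single z Q → Single z Q′) → Outcome ε
    dropLast : ∀ {y Q′} → let open Ear ε in P ≡ [ y ] → M f y → a ⟶ y → y ⟶ b → Walk b Q′ a →
        Q′ ++ f ∷ y ∷ H ↭ V → Outcome ε

  module Block {Q G P H} (ε : Ear Q G P H) (τ : Tight ε) where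
    open Ear ε
    open Tight τ

    unique : Unique (Q ++ G ++ P ++ H)
    unique = cover-unique cover

    G≢P : ∀ {x y} → x ∈ G → y ∈ P → x ≢ y
    G≢P x∈ y∈ = unique⇒≢ G (unique-++ʳ Q unique) x∈ (∈-++⁺ˡ y∈)

    -- The initial segment of `P` up to `y` is a path as in `early`.
    P↛G : ∀ {x y} → y ∈ P → x ∈ G → ¬ y ⟶ x
    P↛G {y = y} y∈ x∈ e with reach walkP y∈
    ... | l , r , eq , bf , _ = early (upto bf) e x∈
      (↭-trans (solve 4 (λ l y r h → (l ⊕ y) ⊕ (r ⊕ h) ⊜ (l ⊕ (y ⊕ r)) ⊕ h) ↭-refl l [ y ] r H)
        (↭-reflexive (cong (_++ H) (sym eq))))

    G↛P : ∀ {x y} → x ∈ G → y ∈ P → ¬ x ⟶ y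
    G↛P {y = y} x∈ y∈ e with reach walkP y∈
    ... | l , r , eq , _ , af = late x∈ e (from af)
      (↭-trans (solve 4 (λ l y r h → (y ⊕ r) ⊕ (l ⊕ h) ⊜ (l ⊕ (y ⊕ r)) ⊕ h) ↭-refl l [ y ] r H)
        (↭-reflexive (cong (_++ H) (sym eq))))

    q↛H↛G : ∀ {w x} → w ∈ H → x ∈ G → q ⟶ w → ¬ w ⟶ x
    q↛H↛G {w} w∈ x∈ q⟶w w⟶x with pick w∈
    ... | H′ , H↭ = early (join walkP q⟶w one) w⟶x x∈
      (↭-trans (↭-reflexive (++-assoc P [ w ] H′)) (++⁺ˡ P (↭-sym H↭)))

    G↛H↛p : ∀ {x w} → x ∈ G → w ∈ H → x ⟶ w → ¬ w ⟶ p
    G↛H↛p {w = w} x∈ w∈ x⟶w w⟶p with pick w∈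
    ... | H′ , H↭ = late x∈ x⟶w (w⟶p ◂ walkP)
      (↭-trans (↭-sym (shift w P H′)) (++⁺ˡ P (↭-sym H↭)))

    -- With `P` placed inside `Q`, the block `G` still closes the cycle, which is then too long.
    insertP : inFrom p Q + outTo q Q ≤ 1 + length Q
    insertP with insert walkQ walkP
    ... | inj₂ bound = bound
    ... | inj₁ i = ⊥-elim (longer P H longest (_ , _ , join (Inserted.walk i) a⟶e walkG , f⟶b)
      (↭-trans (++⁺ʳ H (++⁺ʳ G (Inserted.perm i)))
        (↭-trans (solve 4 (λ q p g h → ((q ⊕ p) ⊕ g) ⊕ h ⊜ q ⊕ (g ⊕ (p ⊕ h))) ↭-refl Q P G H) cover))
      ↭-refl (nonempty walkP))

    -- `P` takes over from `G` the connection from `a` to `b`: nothing of `G` is lost and all of `P`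
    -- is gained.
    ¬insertG : ∀ {B} → Inserted b Q a B → B ↭ G → ⊥
    ¬insertG {B} i B↭G = longer P H longest (_ , _ , join (Inserted.walk i) a⟶p walkP , q⟶b)
      (↭-trans (++⁺ʳ H (++⁺ʳ P (↭-trans (Inserted.perm i) (++⁺ˡ Q B↭G))))
        (↭-trans (solve 4 (λ q p g h → ((q ⊕ g) ⊕ p) ⊕ h ⊜ q ⊕ (g ⊕ (p ⊕ h))) ↭-refl Q P G H) cover))
      ↭-refl (nonempty walkP)

    length₄ : length Q + (length G + (length P + length H)) ≤ n
    length₄ = ≤-reflexive (trans (sym (split₄ length-additive Q G P H cover)) ∣V∣)

    -- Otherwise 2n ≤ κ V ≤ 2n − 2, where κ V is the sum of the degrees at hand.
    core : ∀ {e′ B f′ X} → Walk e′ B f′ → G ↭ B ++ X → ¬ M q e′ → ¬ M f′ p → Inserted b Q a B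
    core {e′} {B} {f′} {X} w G↭ ¬Mqe ¬Mfp with insert walkQ w
    ... | inj₁ i = i
    ... | inj₂ insertB = ⊥-elim (core-arith n (length Q) (length G) (length P) (length H) (κ Q) (κ G)
        (κ P) (κ H) length₄
      (≤-trans (heavy (λ eq → G≢P e∈ q∈ (sym eq)) (P↛G q∈ e∈) ¬Mqe ⊞ heavy (G≢P f∈ p∈) (G↛P f∈ p∈) ¬Mfp)
        (≤-reflexive (split₄ κ-additive Q G P H cover)))
      (core-Q (outTo q Q) (inFrom e′ Q) (outTo f′ Q) (inFrom p Q) (length Q) insertP insertB)
      (core-G (outTo q G) (inFrom e′ G) (outTo f′ G) (inFrom p G) (#-none (q ⟶?_) (P↛G q∈))
          (#<length (_⟶? e′) e∈ loopless)
        (#<length (f′ ⟶?_) f∈ loopless) (#-none (_⟶? p) λ x∈ → G↛P x∈ p∈))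
      (core-P (outTo q P) (inFrom e′ P) (outTo f′ P) (inFrom p P) (#<length (q ⟶?_) q∈ loopless)
          (#-none (_⟶? e′) λ y∈ → P↛G y∈ e∈)
        (#-none (f′ ⟶?_) (G↛P f∈)) (#<length (_⟶? p) p∈ loopless))
      (core-H (outTo q H) (inFrom e′ H) (outTo f′ H) (inFrom p H)
          (#-disjoint (q ⟶?_) (_⟶? e′) H λ w∈ → q↛H↛G w∈ e∈)
        (#-disjoint (f′ ⟶?_) (_⟶? p) H λ w∈ → G↛H↛p f∈ w∈)))
      where
      κ : Vertices → ℕ
      κ xs = (outTo q xs + inFrom e′ xs) + (outTo f′ xs + inFrom p xs)
      κ-additive : Additive κ
      κ-additive = (outTo-additive q +ᵃ inFrom-additive e′) +ᵃ (outTo-additive f′ +ᵃ inFrom-additive p)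
      q∈ : q ∈ P
      q∈ = last∈ walkP
      p∈ : p ∈ P
      p∈ = first∈ walkP
      e∈ : e′ ∈ G
      e∈ = ∈-resp-↭ (↭-sym G↭) (∈-++⁺ˡ (first∈ w))
      f∈ : f′ ∈ G
      f∈ = ∈-resp-↭ (↭-sym G↭) (∈-++⁺ˡ (last∈ w))

    -- `Q`, `B` and `P` form a cycle that misses only `x` and `H`; as no cycle misses fewer vertices
    -- than `P ++ H` has, `P` is a single vertex.
    solo : ∀ {x B} → Inserted b Q a B → G ↭ x ∷ B → P ≡ [ q ] × p ≡ q
    solo {x} {B} i G↭ = short walkP (+-cancelʳ-≤ (length H) (length P) 1 (≤-trans
      (≤-reflexive (sym (length-++ P)))
      (longest (_ , _ , join i.walk a⟶p walkP , q⟶b)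
        (↭-trans (++⁺ʳ (x ∷ H) (++⁺ʳ P i.perm))
          (↭-trans (solve 5 (λ q b p x h → ((q ⊕ b) ⊕ p) ⊕ (x ⊕ h) ⊜ q ⊕ ((x ⊕ b) ⊕ (p ⊕ h))) ↭-refl
              Q B P [ x ] H)
            (↭-trans (++⁺ˡ Q (++⁺ʳ (P ++ H) (↭-sym G↭))) cover))))))
      where
      module i = Inserted i
      short : ∀ {s xs t} → Walk s xs t → length xs ≤ 1 → xs ≡ [ t ] × s ≡ t
      short one _ = refl , refl
      short (_ ◂ one) (s≤s ())
      short (_ ◂ _ ◂ _) (s≤s ())

    leftover : ∀ {x B} (i : Inserted b Q a B) → G ↭ x ∷ B → P ≡ [ q ] → Inserted.list i ++ x ∷ q ∷ H ↭ V
    leftover {x} {B} i G↭ P≡ = ↭-trans (++⁺ʳ (x ∷ q ∷ H) (Inserted.perm i))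
      (↭-trans (solve 5 (λ q b p x h → (q ⊕ b) ⊕ (x ⊕ (p ⊕ h)) ⊜ q ⊕ ((x ⊕ b) ⊕ (p ⊕ h))) ↭-refl
          Q B [ q ] [ x ] H)
        (↭-trans (++⁺ˡ Q (++⁺ʳ (q ∷ H) (↭-sym G↭))) (subst (λ P → Q ++ G ++ P ++ H ↭ V) P≡ cover)))

    outcomeFirst : ∀ {B} → M q e → Inserted b Q a B → G ↭ e ∷ B → Outcome ε
    outcomeFirst m i G↭ with solo i G↭
    ... | P≡ , p≡q = dropFirst P≡ m (subst (a ⟶_) p≡q a⟶p) q⟶b (Inserted.walk i) (leftover i G↭ P≡)
      λ far → Inserted.single i λ g∈ → far (∈-resp-↭ (↭-sym G↭) (there g∈))

    outcomeLast : ∀ {B} → M f p → Inserted b Q a B → G ↭ f ∷ B → Outcome ε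
    outcomeLast m i G↭ with solo i G↭
    ... | P≡ , p≡q = dropLast P≡ (subst (M f) p≡q m) (subst (a ⟶_) p≡q a⟶p) q⟶b
      (Inserted.walk i) (leftover i G↭ P≡)

    module _ (e≢f : e ≢ f) (Mqe : M q e) (Mfp : M f p) {B} (G↭ : G ↭ e ∷ f ∷ B)
        (i : Inserted b Q a B) where
      private
        module i = Inserted i
        q∈ : q ∈ P
        q∈ = last∈ walkP
        p∈ : p ∈ P
        p∈ = first∈ walkP
        e∈ : e ∈ G
        e∈ = first∈ walkG
        f∈ : f ∈ G
        f∈ = last∈ walkG
        ⊂G : ∀ {x} → x ∈ B → x ∈ G
        ⊂G x∈ = ∈-resp-↭ (↭-sym G↭) (there (there x∈))
        ef : Vertices
        ef = e ∷ f ∷ []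
        ef⊂G : ∀ {x} → x ∈ ef → x ∈ G
        ef⊂G x∈ = ∈-resp-↭ (↭-sym G↭) (∈-++⁺ˡ x∈)

        cover₅ : Q ++ B ++ ef ++ P ++ H ↭ V
        cover₅ = ↭-trans (solve 4 (λ q b x r → q ⊕ (b ⊕ (x ⊕ r)) ⊜ q ⊕ ((x ⊕ b) ⊕ r)) ↭-refl
            Q B ef (P ++ H))
          (↭-trans (++⁺ˡ Q (++⁺ʳ (P ++ H) (↭-sym G↭))) cover)

        length₅ : length Q + (length B + (2 + (length P + length H))) ≤ n
        length₅ = ≤-reflexive (trans (sym (split₅ length-additive Q B ef P H cover₅)) ∣V∣)

        spread : ∀ {κ} → Additive κ → κ i.list ≡ κ Q + κ B
        spread α = trans (Additive.↭-inv α i.perm) (Additive.++-hom α Q B)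

        spreadBound : ∀ {u v} → inFrom u i.list + outTo v i.list ≤ 1 + length i.list →
          (inFrom u Q + inFrom u B) + (outTo v Q + outTo v B) ≤ 1 + (length Q + length B)
        spreadBound {u} {v} bound = ≤-trans
          (≤-reflexive (sym (cong₂ _+_ (spread (inFrom-additive u)) (spread (outTo-additive v)))))
          (≤-trans bound (≤-reflexive (cong suc (spread length-additive))))

        -- `M` links `f` to `p` and `q` to `e`, so injectivity and functionality leave `(e , p)`,
        -- and likewise `(q , f)`, unexceptional.
        heavy-ep : n ≤ outTo e V + inFrom p V
        heavy-ep = heavy (G≢P e∈ p∈) (G↛P e∈ p∈) λ m → e≢f (M-injective m Mfp)

        heavy-qf : n ≤ outTo q V + inFrom f V
        heavy-qf = heavy (λ eq → G≢P f∈ q∈ (sym eq)) (P↛G q∈ f∈) λ m → e≢f (M-functional Mqe m)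

        α β γ δ ξ υ κ κ′ : Vertices → ℕ
        α = outTo e
        β = inFrom p
        γ = outTo q
        δ = inFrom f
        ξ = outTo f
        υ = inFrom e
        κ xs = (α xs + β xs) + (γ xs + δ xs)
        κ′ xs = (α xs + β xs) + ((γ xs + δ xs) + (ξ xs + υ xs))

        κ-additive : Additive κ
        κ-additive = (outTo-additive e +ᵃ inFrom-additive p) +ᵃ (outTo-additive q +ᵃ inFrom-additive f)
        κ′-additive : Additive κ′
        κ′-additive = (outTo-additive e +ᵃ inFrom-additive p) +ᵃ ((outTo-additive q +ᵃ inFrom-additive f) +ᵃ (outTo-additive f +ᵃ inFrom-additive e))

        -- If f ⟶ e, the two ends can also be inserted in reversed order.
        swapped : f ⟶ e → Inserted b i.list a (f ∷ e ∷ []) ⊎ inFrom f i.list + outTo e i.list ≤ 1 + length i.list → ⊥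
        swapped f⟶e (inj₁ j) = ¬insertG (compose i j)
          (↭-trans (solve 3 (λ b f e → b ⊕ (f ⊕ e) ⊜ e ⊕ (f ⊕ b)) ↭-refl B [ f ] [ e ]) (↭-sym G↭))
        swapped f⟶e (inj₂ bound) = swap-arith n (length Q) (length B) (length P) (length H) (κ Q) (κ B)
            (κ ef) (κ P) (κ H)
          length₅ total (κ-Q bound) κ-ef κ-P κ-H
          where
          total : n + n ≤ κ Q + (κ B + (κ ef + (κ P + κ H)))
          total = ≤-trans (heavy-ep ⊞ heavy-qf) (≤-reflexive (split₅ κ-additive Q B ef P H cover₅))
          κ-Q : inFrom f i.list + outTo e i.list ≤ 1 + length i.list →
              κ Q + κ B ≤ (1 + (length Q + length B)) + (1 + length Q)
          κ-Q bound = swap-Q (α Q) (β Q) (γ Q) (δ Q) (α B) (δ B) (length Q) (length B)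
              (spreadBound bound) insertP
            (#-none (_⟶? p) λ x∈ → G↛P (⊂G x∈) p∈) (#-none (q ⟶?_) λ x∈ → P↛G q∈ (⊂G x∈))
          κ-ef : κ ef ≤ 2
          κ-ef = swap-X (α ef) (β ef) (γ ef) (δ ef) (#<length (e ⟶?_) (here refl) loopless)
            (#-none (_⟶? p) λ x∈ → G↛P (ef⊂G x∈) p∈) (#-none (q ⟶?_) λ x∈ → P↛G q∈ (ef⊂G x∈))
            (#<length (_⟶? f) (there (here refl)) loopless)
          κ-P : 2 + κ P ≤ length P + length P
          κ-P = swap-P (α P) (β P) (γ P) (δ P) (#-none (e ⟶?_) (G↛P e∈)) (#<length (_⟶? p) p∈ loopless)
            (#<length (q ⟶?_) q∈ loopless) (#-none (_⟶? f) λ y∈ → P↛G y∈ f∈)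
          κ-H : κ H ≤ length H + length H
          κ-H = core-H (α H) (β H) (γ H) (δ H) (#-disjoint (e ⟶?_) (_⟶? p) H λ w∈ → G↛H↛p e∈ w∈)
            (#-disjoint (q ⟶?_) (_⟶? f) H λ w∈ → q↛H↛G w∈ f∈)

        -- The degrees of `(e , p)`, `(q , f)`, `(f , e)` are added. Over `H` they are regrouped as
        -- the excluded connections `q` to `e`, `f` to `p` and `e` to `f`, the last one by `mid`.
        stuck : ¬ f ⟶ e → inFrom e i.list + outTo e i.list ≤ 1 + length i.list →
          inFrom f i.list + outTo f i.list ≤ 1 + length i.list → ⊥
        stuck f↛e bound bound′ = turn-arith n (length Q) (length B) (length P) (length H) (κ′ Q) (κ′ B)
            (κ′ ef) (κ′ P) (κ′ H) length₅
          (≤-trans (heavy-ep ⊞ heavy-qf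
              ⊞ heavy (λ eq → e≢f (sym eq)) f↛e (λ m → G≢P e∈ p∈ (M-functional m Mfp)))
            (≤-reflexive (split₅ κ′-additive Q B ef P H cover₅)))
          (turn-Q (α Q) (β Q) (γ Q) (δ Q) (ξ Q) (υ Q) (α B) (δ B) (ξ B) (υ B) (length Q) (length B)
              (spreadBound bound) (spreadBound bound′) insertP
            (#-none (_⟶? p) λ x∈ → G↛P (⊂G x∈) p∈) (#-none (q ⟶?_) λ x∈ → P↛G q∈ (⊂G x∈)))
          (turn-X (α ef) (β ef) (γ ef) (δ ef) (ξ ef) (υ ef) (#<length (e ⟶?_) (here refl) loopless)
              (#-none (_⟶? p) λ x∈ → G↛P (ef⊂G x∈) p∈)
            (#-none (q ⟶?_) λ x∈ → P↛G q∈ (ef⊂G x∈)) (#<length (_⟶? f) (there (here refl)) loopless)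
            (#-none (f ⟶?_) λ { (here refl) → f↛e ; (there (here refl)) → loopless })
            (#-none (_⟶? e) λ { (here refl) → loopless ; (there (here refl)) → f↛e }))
          (turn-P (α P) (β P) (γ P) (δ P) (ξ P) (υ P) (#-none (e ⟶?_) (G↛P e∈))
              (#<length (_⟶? p) p∈ loopless)
            (#<length (q ⟶?_) q∈ loopless) (#-none (_⟶? f) λ y∈ → P↛G y∈ f∈)
            (#-none (f ⟶?_) (G↛P f∈)) (#-none (_⟶? e) λ y∈ → P↛G y∈ e∈))
          (turn-H (α H) (β H) (γ H) (δ H) (ξ H) (υ H) (#-disjoint (q ⟶?_) (_⟶? e) H λ w∈ → q↛H↛G w∈ e∈)
              (#-disjoint (f ⟶?_) (_⟶? p) H λ w∈ → G↛H↛p f∈ w∈)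
            (#-disjoint (e ⟶?_) (_⟶? f) H λ w∈ → mid w∈ e≢f))

      -- Once one of `e`, `f` is inserted as well, the other is the vertex to drop.
      both : Outcome ε
      both with f ⟶? e
      ... | yes f⟶e = ⊥-elim (swapped f⟶e (insert i.walk (f⟶e ◂ one)))
      ... | no f↛e with insert i.walk (one {e}) | insert i.walk (one {f})
      ...   | inj₁ j | _ = outcomeLast Mfp (compose i j)
        (↭-trans G↭ (solve 3 (λ b f e → e ⊕ (f ⊕ b) ⊜ f ⊕ (b ⊕ e)) ↭-refl B [ f ] [ e ]))
      ...   | inj₂ _ | inj₁ j = outcomeFirst Mqe (compose i j)
        (↭-trans G↭ (solve 3 (λ b f e → e ⊕ (f ⊕ b) ⊜ e ⊕ (b ⊕ f)) ↭-refl B [ f ] [ e ]))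
      ...   | inj₂ bound | inj₂ bound′ = ⊥-elim (stuck f↛e bound bound′)

    apart : ∀ l {r x y} → G ≡ l ++ r → x ∈ l → y ∈ r → x ≢ y
    apart l {r} eq x∈ y∈ = unique⇒≢ l
      (subst Unique (++-assoc l r (P ++ H))
          (subst (λ G → Unique (G ++ P ++ H)) eq (unique-++ʳ Q unique))) x∈ (∈-++⁺ˡ y∈)

    -- If `M` links neither `q` to `e` nor `f` to `p`, all of `G` can be inserted, which is
    -- impossible. A linked end is set aside; functionality or injectivity of `M` frees the new end,
    -- and `core` inserts the rest.
    block : Outcome ε
    block with M? q e | M? f p
    ... | no ¬Mqe | no ¬Mfp =
        ⊥-elim (¬insertG (core walkG (↭-reflexive (sym (++-identityʳ G))) ¬Mqe ¬Mfp) ↭-refl)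
    ... | yes Mqe | no ¬Mfp with uncons walkG
    ...   | inj₁ (eq , _) = outcomeFirst Mqe (idle walkQ) (↭-reflexive eq)
    ...   | inj₂ (g , l , eq , _ , w) = outcomeFirst Mqe
      (core w (↭-trans (↭-reflexive eq) (solve 2 (λ e l → e ⊕ l ⊜ l ⊕ e) ↭-refl [ e ] l))
        (λ m → apart [ e ] eq (here refl) (first∈ w) (M-functional Mqe m)) ¬Mfp)
      (↭-reflexive eq)
    block | no ¬Mqe | yes Mfp with unsnoc walkG
    ...   | inj₁ (eq , e≡f) = outcomeLast Mfp (idle walkQ) (↭-reflexive eq)
    ...   | inj₂ (l , g , eq , w , _) = outcomeLast Mfp
      (core w (↭-reflexive eq) ¬Mqe (λ m → apart l eq (last∈ w) (here refl) (M-injective m Mfp)))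
      (↭-trans (↭-reflexive eq) (solve 2 (λ f l → l ⊕ f ⊜ f ⊕ l) ↭-refl [ f ] l))
    block | yes Mqe | yes Mfp with uncons walkG
    -- With `e = f` and `p = q`, the two links are `M q e` and `M e q`.
    ...   | inj₁ (eq , e≡f) = ⊥-elim (M-asym Mqe
      (subst (λ u → M u q) (sym e≡f) (subst (M f) (proj₂ (solo (idle walkQ) (↭-reflexive eq))) Mfp)))
    ...   | inj₂ (g , l , eq , _ , w) with unsnoc w
    ...     | inj₁ (refl , _) = both (apart [ e ] eq (here refl) (here refl)) Mqe Mfp (↭-reflexive eq)
        (idle walkQ)
    ...     | inj₂ (l′ , g′ , refl , w′ , _) =
        both (apart [ e ] eq (here refl) (∈-++⁺ʳ l′ (here refl))) Mqe Mfp
      (↭-trans (↭-reflexive eq) (solve 3 (λ e l f → e ⊕ (l ⊕ f) ⊜ e ⊕ (f ⊕ l)) ↭-refl [ e ] l′ [ f ]))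
      (core w′ (↭-trans (↭-reflexive eq)
          (solve 3 (λ e l f → e ⊕ (l ⊕ f) ⊜ l ⊕ (e ⊕ f)) ↭-refl [ e ] l′ [ f ]))
        (λ m → apart [ e ] eq (here refl) (∈-++⁺ˡ (first∈ w′)) (M-functional Mqe m))
        (λ m → apart (e ∷ l′) eq (there (last∈ w′)) (here refl) (M-injective m Mfp)))

  -- Two longest cycles with common missed vertices

  split₃ : ∀ {κ} → Additive κ → ∀ xs y zs → xs ++ y ∷ zs ↭ V → κ V ≡ κ xs + (κ [ y ] + κ zs)
  split₃ {κ} α xs y zs p = trans (split₂ α xs (y ∷ zs) p) (cong (κ xs +_) (Additive.++-hom α [ y ] zs))

  missing-length : ∀ {C y R} → C ++ y ∷ R ↭ V → length C + (1 + length R) ≤ n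
  missing-length {C} cover = ≤-reflexive (trans (sym (split₂ length-additive C _ cover)) ∣V∣)

  -- The closing step from `t` to `s` is also a place for insertion; counting it removes the `1 +`
  -- that `insert` has.
  cyclicBound : ∀ {C p B q} R R′ → Longest (length R) → Cycle C → C ++ R ↭ V → Walk p B q →
      B ++ R′ ↭ R →
    inFrom p C + outTo q C ≤ length C
  cyclicBound {C} {p} {B} {q} R R′ longest (s , t , w , t⟶s) cover w′ perm
    with consecutive (_⟶? p) (q ⟶?_) w
  ... | inj₁ c = ⊥-elim (longer B R′ longest (_ , _ , Inserted.walk i , t⟶s)
      (↭-trans (++⁺ʳ R′ (Inserted.perm i))
          (↭-trans (↭-reflexive (++-assoc C B R′)) (↭-trans (++⁺ˡ C perm) cover)))
      perm (nonempty w′))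
    where
    i : Inserted s C t B
    i = insertAt w w′ c
  ... | inj₂ bound with #-both (q ⟶?_) (_⟶? p) s t
  ...   | inj₂ ends = tighten-cyclic (inFrom p C) (outTo q C) (outTo q [ s ]) (inFrom p [ t ])
      (length C) bound ends
  ...   | inj₁ (q⟶s , t⟶p) = ⊥-elim (longer B R′ longest (_ , _ , join w t⟶p w′ , q⟶s)
      (↭-trans (↭-reflexive (++-assoc C B R′)) (↭-trans (++⁺ˡ C perm) cover)) perm (nonempty w′))

  M-irrefl : ∀ {u v} → M u v → u ≢ v
  M-irrefl m refl = M-asym m m

  -- The cycles before and after an exchange. The last three hypotheses exclude detours between `α`
  -- and `β` through one or two vertices of `H`.
  module TwoCycles {α β C₁ C₂ H} (longest : Longest (suc (length H)))
    (cycle₁ : Cycle C₁) (cover₁ : C₁ ++ α ∷ H ↭ V) (cycle₂ : Cycle C₂) (cover₂ : C₂ ++ β ∷ H ↭ V)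
    (Mαβ : M α β) (β↛α : ¬ β ⟶ α)
    (βHα : ∀ {w} → w ∈ H → β ⟶ w → ¬ w ⟶ α)
    (αHβ : ∀ {w} → w ∈ H → α ⟶ w → ¬ w ⟶ β)
    (αHHβ : ∀ {w w′} → w ∈ H → w′ ∈ H → α ⟶ w → w ⟶ w′ → ¬ w′ ⟶ β) where

    heavy-βα : n ≤ outTo β V + inFrom α V
    heavy-βα = heavy (λ eq → M-irrefl Mαβ (sym eq)) β↛α (M-asym Mαβ)

    ≢α : ∀ {w} → w ∈ H → α ≢ w
    ≢α = unique⇒≢ [ α ] (unique-++ʳ C₁ (cover-unique cover₁)) (here refl)

    ≢β : ∀ {w} → w ∈ H → β ≢ w
    ≢β = unique⇒≢ [ β ] (unique-++ʳ C₂ (cover-unique cover₂)) (here refl)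

    heavy-wβ : ∀ {w} → w ∈ H → ¬ w ⟶ β → n ≤ outTo w V + inFrom β V
    heavy-wβ w∈ w↛β = heavy (λ eq → ≢β w∈ (sym eq)) w↛β λ m → ≢α w∈ (M-injective Mαβ m)

    heavy-αw : ∀ {w} → w ∈ H → ¬ α ⟶ w → n ≤ outTo α V + inFrom w V
    heavy-αw w∈ α↛w = heavy (≢α w∈) α↛w λ m → ≢β w∈ (M-functional Mαβ m)

    over : ∀ k {κ κ′} → Additive κ → Additive κ′ → ∀ {C C′ x y} → C ++ x ∷ H ↭ V → C′ ++ y ∷ H ↭ V →
      n ≤ κ V + κ′ V → κ [ x ] + κ′ [ y ] ≤ k → n ≤ (κ C + κ H) + (κ′ C′ + κ′ H) + k
    over k {κ} {κ′} α β {C} {C′} {x} {y} cover cover′ h =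
      drop-middle n k (κ C) (κ [ x ]) (κ H) (κ′ C′) (κ′ [ y ]) (κ′ H)
        (≤-trans h (≤-reflexive (cong₂ _+_ (split₃ α C x H cover) (split₃ β C′ y H cover′))))

    self : ∀ v → inFrom v [ v ] ≤ 0
    self v = #-none (_⟶? v) λ { (here refl) → loopless }

    self′ : ∀ v → outTo v [ v ] ≤ 0
    self′ v = #-none (v ⟶?_) λ { (here refl) → loopless }

    viaH : outTo β H + inFrom α H ≤ length H
    viaH = #-disjoint (β ⟶?_) (_⟶? α) H βHα

    -- Counts the pairs `(w , β)` and `(β , α)`: the path from `α` to `w` cannot be inserted into
    -- `C₁`, nor `β` into `C₂`.
    out-of-α : ∀ {w} → w ∈ H → α ⟶ w → ⊥
    out-of-α {w} w∈ α⟶w with pick w∈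
    ... | H′ , H↭ = kill-arith n (length C₁) (length C₂) (length H)
      (outTo w C₁) (outTo w H) (inFrom β C₂) (inFrom β H) (outTo β C₂) (outTo β H) (inFrom α C₁)
          (inFrom α H)
      (missing-length cover₁) (missing-length cover₂)
      (over 1 (outTo-additive w) (inFrom-additive β) cover₁ cover₂ (heavy-wβ w∈ (αHβ w∈ α⟶w))
          (#-single (w ⟶?_) α ⊞ self β))
      (over 0 (outTo-additive β) (inFrom-additive α) cover₂ cover₁ heavy-βα (self′ β ⊞ self α))
      (#-disjoint< (w ⟶?_) (_⟶? β) w∈ loopless (αHβ w∈ α⟶w) λ w′∈ → αHHβ w∈ w′∈ α⟶w)
      viaH
      (cyclicBound (α ∷ H) H′ longest cycle₁ cover₁ (α⟶w ◂ one) (++⁺ˡ [ α ] (↭-sym H↭)))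
      (cyclicBound (β ∷ H) H longest cycle₂ cover₂ one ↭-refl)

    -- Dually, with the pair `(α , w)` and the path from `w` to `β` beside `C₂`.
    into-β : ∀ {w} → w ∈ H → w ⟶ β → ⊥
    into-β {w} w∈ w⟶β with pick w∈
    ... | H′ , H↭ = kill-arith n (length C₁) (length C₂) (length H)
      (outTo α C₁) (outTo α H) (inFrom w C₂) (inFrom w H) (outTo β C₂) (outTo β H) (inFrom α C₁)
          (inFrom α H)
      (missing-length cover₁) (missing-length cover₂)
      (over 1 (outTo-additive α) (inFrom-additive w) cover₁ cover₂ (heavy-αw w∈ λ α⟶w → αHβ w∈ α⟶w w⟶β)
          (self′ α ⊞ #-single (_⟶? w) β))
      (over 0 (outTo-additive β) (inFrom-additive α) cover₂ cover₁ heavy-βα (self′ β ⊞ self α))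
      (#-disjoint< (α ⟶?_) (_⟶? w) w∈ (λ α⟶w → αHβ w∈ α⟶w w⟶β) loopless λ w′∈ α⟶w′ w′⟶w →
          αHHβ w′∈ w∈ α⟶w′ w′⟶w w⟶β)
      viaH
      (cyclicBound (α ∷ H) H longest cycle₁ cover₁ one ↭-refl)
      (cyclicBound (β ∷ H) H′ longest cycle₂ cover₂ (w⟶β ◂ one)
        (↭-trans (solve 3 (λ w b h → (w ⊕ b) ⊕ h ⊜ b ⊕ (w ⊕ h)) ↭-refl [ w ] [ β ] H′)
            (++⁺ˡ [ β ] (↭-sym H↭))))

    -- The pairs `(α , w)`, `(w , β)`, `(β , α)` use both degrees of each of the three vertices, and
    -- these degrees are too small now that `α` sends no arc into `H` and `β` receives none from it.
    H-empty : ∀ {w} → w ∈ H → ⊥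
    H-empty {w} w∈ with pick w∈
    ... | H′ , H↭ = kill-arith′ n (length C₁) (length C₂) (length H)
      (outTo α V) (inFrom α V) (outTo β V) (inFrom β V) (outTo w V) (inFrom w V) (inFrom α H)
          (outTo β H)
      (missing-length cover₁) (missing-length cover₂)
      (heavy-αw w∈ (out-of-α w∈)) (heavy-wβ w∈ (into-β w∈)) heavy-βα
      (≤-trans (≤-reflexive (sum α cover₁))
        (degree-own (length C₁) (inFrom α H) (outTo α C₁) (outTo α [ α ]) (outTo α H) (inFrom α C₁)
            (inFrom α [ α ]) (inFrom α H)
          (cyclicBound (α ∷ H) H longest cycle₁ cover₁ one ↭-refl) (self′ α) (self α)
          (#-none (α ⟶?_) out-of-α ⊞ ≤-refl)))
      (≤-trans (≤-reflexive (sum β cover₂))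
        (degree-own (length C₂) (outTo β H) (outTo β C₂) (outTo β [ β ]) (outTo β H) (inFrom β C₂)
            (inFrom β [ β ]) (inFrom β H)
          (cyclicBound (β ∷ H) H longest cycle₂ cover₂ one ↭-refl) (self′ β) (self β)
          (≤-trans (≤-refl ⊞ #-none (_⟶? β) into-β) (≤-reflexive (+-identityʳ (outTo β H))))))
      (≤-trans (≤-reflexive (cong suc (sum w cover₁)))
        (degree-other (length C₁) (length H) (outTo w C₁) (outTo w [ α ]) (outTo w H) (inFrom w C₁)
            (inFrom w [ α ]) (inFrom w H)
          (cyclicBound (α ∷ H) (α ∷ H′) longest cycle₁ cover₁ (one {w})
            (↭-trans (solve 3 (λ w a h → w ⊕ (a ⊕ h) ⊜ a ⊕ (w ⊕ h)) ↭-refl [ w ] [ α ] H′)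
                (++⁺ˡ [ α ] (↭-sym H↭))))
          (#-single (w ⟶?_) α) (#-none (_⟶? w) λ { (here refl) → out-of-α w∈ })
          (#<length (w ⟶?_) w∈ loopless) (#<length (_⟶? w) w∈ loopless)))
      viaH
      where
      sum : ∀ v {C x} → C ++ x ∷ H ↭ V → outTo v V + inFrom v V ≡
        (outTo v C + (outTo v [ x ] + outTo v H)) + (inFrom v C + (inFrom v [ x ] + inFrom v H))
      sum v {C} {x} cover = cong₂ _+_ (split₃ (outTo-additive v) C x H cover)
          (split₃ (inFrom-additive v) C x H cover)

  -- From longest cycles to ears

  rotate : ∀ {C t} → Cycle C → t ∈ C → ∃₂ λ r l → Walk t (t ∷ r) l × l ⟶ t × t ∷ r ↭ C
  rotate (_ , _ , w , e⟶s) t∈ with reach w t∈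
  ... | _ , r , refl , first , af = r , _ , from af , e⟶s , ↭-refl
  ... | l , r , refl , after w′ p⟶t , af = r ++ l , _ , join (from af) e⟶s w′ , p⟶t ,
    solve 2 (λ t l → t ⊕ l ⊜ l ⊕ t) ↭-refl (_ ∷ r) l

  -- An excursion leaves `C` at `c` and returns at `t`. Rotated to start at `t`, the cycle splits
  -- into `Q`, ending at `c`, and the remainder `G`.
  earFrom : ∀ {C R} → Longest (length R) → Cycle C → C ++ R ↭ V → 1 ≤ length R →
    ∃₂ λ Q G → ∃₂ λ P H → Ear Q G P H × P ++ H ↭ R
  earFrom {C} {R} longest c@(_ , _ , w , _) cover 1≤R with excursion C R cover (nonempty w) 1≤R
  ... | record { c∈T = c∈ ; t∈T = t∈ ; c⟶p = c⟶p ; walk = w′ ; s⟶t = s⟶t ; path = ys ; others =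
      zs ; perm = perm }
    with rotate c t∈
  ...   | r , l , w″ , l⟶t , r↭ with reach w″ (∈-resp-↭ (↭-sym r↭) c∈)
  -- With nothing after `c`, the excursion itself leads back to the start and lengthens the cycle.
  ...     | x , [] , eq , bf , final = ⊥-elim (longer ys zs longest (_ , _ , join w″ c⟶p w′ , s⟶t)
              (↭-trans (↭-reflexive (++-assoc (_ ∷ r) ys zs))
                  (↭-trans (++⁺ʳ (ys ++ zs) r↭) (↭-trans (++⁺ˡ C perm) cover)))
              perm (nonempty w′))
  ...     | x , g , eq , bf , next c⟶g wG = _ , g , ys , zs , record
              { walkQ = upto bf ; walkG = wG ; walkP = w′ ; a⟶e = c⟶g ; f⟶b = l⟶t ; a⟶p = c⟶p ; q⟶b =
                  s⟶t
              ; cover = ↭-trans (solve 4 (λ x c g r → (x ⊕ c) ⊕ (g ⊕ r) ⊜ (x ⊕ (c ⊕ g)) ⊕ r) ↭-refl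
                  x [ _ ] g (ys ++ zs))
                  (↭-trans (++⁺ʳ (ys ++ zs) (↭-trans (↭-reflexive (sym eq)) r↭))
                      (↭-trans (++⁺ˡ C perm) cover))
              ; longest = subst Longest (sym (↭-length perm)) longest } , perm

  -- Cycles that miss a single vertex

  Hamiltonian : Set
  Hamiltonian = ∃ λ C → Cycle C × C ↭ V

  -- With `z` the only missed vertex, the arcs forbidden by `Tight` are arcs between `z` and `G`.
  tightSingleton : ∀ {Q G z} (ε : Ear Q G [ z ] []) → Far z G → Tight ε
  tightSingleton ε far = record
    { early = λ w e x∈ perm → case₁ (∈-resp-↭ perm (∈-++⁺ˡ (last∈ w))) x∈ e
    ; late = λ x∈ e w perm → case₂ (∈-resp-↭ perm (∈-++⁺ˡ (first∈ w))) x∈ e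
    ; mid = λ () }
    where
    case₁ : ∀ {x y} → y ∈ [ _ ] → x ∈ _ → ¬ y ⟶ x
    case₁ (here refl) x∈ = proj₂ (far x∈)
    case₂ : ∀ {x y} → y ∈ [ _ ] → x ∈ _ → ¬ x ⟶ y
    case₂ (here refl) x∈ = proj₁ (far x∈)

  record GapWalks (s : Fin n) (l : Vertices) (u x : Fin n) (B : Vertices) (v : Fin n) (r : Vertices)
      (t : Fin n) : Set where
    field
      {p} : Fin n
      walkA : Walk s (l ++ [ u ]) u
      u⟶x : u ⟶ x
      walkB : Walk x (x ∷ B) p
      p⟶v : p ⟶ v
      walkD : Walk v (v ∷ r) t
      walkAB : Walk s (l ++ u ∷ x ∷ B) p

  gapWalks : ∀ {s L t} → Walk s L t → ∀ l u x B v r → L ≡ l ++ u ∷ (x ∷ B) ++ v ∷ r →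
      GapWalks s l u x B v r t
  gapWalks {s} {t = t} w l u x B v r eq
    with p , w₁ , p⟶v , w₂ ← cut′ (l ++ u ∷ x ∷ B)
      (≤-trans (s≤s z≤n) (≤-trans (m≤n+m _ (length l)) (≤-reflexive (sym (length-++ l)))))
      (subst (λ L → Walk s L t) (trans eq (sym (++-assoc l (u ∷ x ∷ B) (v ∷ r)))) w)
    with wA , u⟶x , wB ← cut l w₁
    = record { walkA = wA ; u⟶x = u⟶x ; walkB = wB ; p⟶v = p⟶v ; walkD = w₂ ; walkAB = w₁ }

  data GapOutcome (z : Fin n) : Vertices → Set where
    isFirst : ∀ {x B C} → M z x → Cycle C → C ++ [ x ] ↭ V → GapOutcome z (x ∷ B)
    isLast : ∀ {x B C} → x ∈ B → M x z → Cycle C → C ++ [ x ] ↭ V → GapOutcome z B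

  module _ (¬ham : ¬ Hamiltonian) where

    longest₁ : Longest 1
    longest₁ {C} {[]} c cover = ⊥-elim (¬ham (C , c , subst (_↭ V) (++-identityʳ C) cover))
    longest₁ {R = _ ∷ _} _ _ = s≤s z≤n

    -- `cyclicBound` for the path consisting of `y` alone, beside a cycle on `n - 1` vertices.
    missing-degree : ∀ {C y} → Cycle C → C ++ [ y ] ↭ V → 1 + (outTo y V + inFrom y V) ≤ n
    missing-degree {C} {y} c cover = subst (λ d → 1 + d ≤ n)
      (sym (cong₂ _+_ (split₂ (outTo-additive y) C [ y ] cover)
          (split₂ (inFrom-additive y) C [ y ] cover)))
      (missing-arith n (length C) (outTo y C) (outTo y [ y ]) (inFrom y C) (inFrom y [ y ])
        (cyclicBound [ y ] [] longest₁ c cover one ↭-refl)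
        (#-none (y ⟶?_) λ { (here refl) → loopless }) (#-none (_⟶? y) λ { (here refl) → loopless })
        (≤-reflexive (trans (sym (split₂ length-additive C [ y ] cover)) ∣V∣)))

    -- By asymmetry of `M` the pair `(y , x)` is unexceptional, so
    -- `d⁺(x) + d⁻(x) < n ≤ d⁺(y) + d⁻(x)`.
    decreases : ∀ {C x y} → M x y → ¬ y ⟶ x → Cycle C → C ++ [ x ] ↭ V → outTo x V < outTo y V
    decreases {x = x} {y} Mxy y↛x c cover = +-cancelʳ-≤ (inFrom x V) _ _
      (≤-trans (missing-degree c cover) (heavy (λ eq → M-irrefl Mxy (sym eq)) y↛x (M-asym Mxy)))

    -- An empty gap takes in `z`. Otherwise the gap serves as `G`, the rest of the cycle as `Q` and
    -- `[ z ]` as `P`; this ear is tight because `z` is far from the gap, so `block` applies.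
    gapOutcome : ∀ {s L t c W d z} → Walk s L t → Walk c W d → t ⟶ c → d ⟶ s → L ++ W ++ [ z ] ↭ V →
      ∀ l u B v r → L ≡ l ++ u ∷ B ++ v ∷ r → u ⟶ z → z ⟶ v → Far z B → GapOutcome z B
    gapOutcome {L = L} {W = W} {z = z} wL wW t⟶c d⟶s cover l u [] v r eq u⟶z z⟶v far = ⊥-elim (¬ham
      (_ , (_ , _ , join i.walk t⟶c wW , d⟶s) ,
        ↭-trans (++⁺ʳ W i.perm)
            (↭-trans (solve 3 (λ l z w → (l ⊕ z) ⊕ w ⊜ l ⊕ (w ⊕ z)) ↭-refl L [ z ] W) cover)))
      where
      module i = Inserted (insertAt wL (one {z}) (at l u v r eq u⟶z z⟶v))
    gapOutcome {s} {L} {t} {W = W} {z = z} wL wW t⟶c d⟶s cover l u (x ∷ B) v r eq u⟶z z⟶v far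
      with Block.block ε (tightSingleton ε far)
      where
      open GapWalks (gapWalks wL l u x B v r eq)
      ε : Ear ((v ∷ r) ++ W ++ l ++ [ u ]) (x ∷ B) [ z ] []
      ε = record
        { walkQ = join walkD t⟶c (join wW d⟶s walkA) ; walkG = walkB ; walkP = one
        ; a⟶e = u⟶x ; f⟶b = p⟶v ; a⟶p = u⟶z ; q⟶b = z⟶v
        ; cover = ↭-trans (solve 6 (λ d w l u b z → (d ⊕ (w ⊕ (l ⊕ u))) ⊕ (b ⊕ z) ⊜
            (l ⊕ (u ⊕ (b ⊕ d))) ⊕ (w ⊕ z)) ↭-refl (v ∷ r) W l [ u ] (x ∷ B) [ z ])
            (↭-trans (++⁺ʳ (W ++ [ z ]) (↭-reflexive (sym eq))) cover)
        ; longest = longest₁ }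
    ... | dropFirst {Q′ = Q′} refl m a⟶z z⟶b w cover′ _ = isFirst m (_ , _ , join w a⟶z one , z⟶b)
      (↭-trans (solve 3 (λ q x z → (q ⊕ z) ⊕ x ⊜ q ⊕ (x ⊕ z)) ↭-refl Q′ [ _ ] [ z ]) cover′)
    ... | dropLast {Q′ = Q′} refl m a⟶z z⟶b w cover′ = isLast
      (last∈ (GapWalks.walkB (gapWalks wL l u x B v r eq))) m (_ , _ , join w a⟶z one , z⟶b)
      (↭-trans (solve 3 (λ q x z → (q ⊕ z) ⊕ x ⊜ q ⊕ (x ⊕ z)) ↭-refl Q′ [ _ ] [ z ]) cover′)

    -- Two nonadjacent vertices beside a Hamiltonian path of the others

    module Final {Q b a e y} (walkQ : Walk b Q a) (cover : Q ++ e ∷ y ∷ [] ↭ V) (Mye : M y e)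
      (a⟶e : a ⟶ e) (a⟶y : a ⟶ y) (y⟶b : y ⟶ b) (e↛y : ¬ e ⟶ y) (y↛e : ¬ y ⟶ e) (single-y : Single y Q)
      {C : Vertices} (cycleC : Cycle C) (coverC : C ++ [ y ] ↭ V) where

      ≢e : ∀ {x} → x ∈ Q → x ≢ e
      ≢e x∈ = unique⇒≢ Q (cover-unique cover) x∈ (here refl)

      ≢y : ∀ {x} → x ∈ Q → x ≢ y
      ≢y x∈ = unique⇒≢ Q (cover-unique cover) x∈ (there (here refl))

      heavy-ey : n ≤ outTo e V + inFrom y V
      heavy-ey = heavy (λ eq → M-irrefl Mye (sym eq)) e↛y (M-asym Mye)

      heavy-xe : ∀ {x} → x ∈ Q → ¬ x ⟶ e → n ≤ outTo x V + inFrom e V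
      heavy-xe x∈ x↛e = heavy (≢e x∈) x↛e λ m → ≢y x∈ (M-injective m Mye)

      heavy-yx : ∀ {x} → x ∈ Q → ¬ y ⟶ x → n ≤ outTo y V + inFrom x V
      heavy-yx x∈ y↛x = heavy (λ eq → ≢y x∈ (sym eq)) y↛x λ m → ≢e x∈ (M-functional m Mye)

      cycleE : Cycle (Q ++ [ y ])
      cycleE = _ , _ , join walkQ a⟶y one , y⟶b

      coverE : (Q ++ [ y ]) ++ [ e ] ↭ V
      coverE = ↭-trans (solve 3 (λ q e y → (q ⊕ y) ⊕ e ⊜ q ⊕ (e ⊕ y)) ↭-refl Q [ e ] [ y ]) cover

      ey : Vertices
      ey = e ∷ y ∷ []

      -- If `y ↛ x`, the pairs `(y , x)`, `(x , e)`, `(e , y)` involve three vertices, each missed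
      -- by some cycle and so of total degree below `n`. If `y ⟶ x`, the end `p` of the gap yields
      -- either a Hamiltonian cycle or too small a degree.
      noGap : ∀ {C′} l u x B v r → Q ≡ l ++ u ∷ (x ∷ B) ++ v ∷ r → u ⟶ e → e ⟶ v → Far e (x ∷ B) →
        M e x → Cycle C′ → C′ ++ [ x ] ↭ V → ⊥
      noGap l u x B v r eq u⟶e e⟶v far Mex cycleX coverX with y ⟶? x
      ... | no y↛x = gap-arith₁ n (outTo x V) (inFrom x V) (outTo e V) (inFrom e V) (outTo y V)
          (inFrom y V)
        (heavy-yx x∈ y↛x) (heavy-xe x∈ (proj₁ (far (here refl)))) heavy-ey
        (missing-degree cycleX coverX) (missing-degree cycleE coverE) (missing-degree cycleC coverC)
        where
        x∈ : x ∈ Q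
        x∈ = subst (x ∈_) (sym eq) (∈-++⁺ʳ l (there (here refl)))
      ... | yes y⟶x with crossing (_⟶? y) (p ⟶?_) walkD
        where
        open GapWalks (gapWalks walkQ l u x B v r eq)
      -- The cycle runs `v … s`, `y`, `b … p`, `s′ … a`, `e` and back to `v`.
      ...   | inj₁ (at l′ s s′ r′ eq′ s⟶y p⟶s′) =
          ¬ham (_ , (_ , _ , join w₁ s⟶y (y⟶b ◂ join walkAB p⟶s′ (join w₂ a⟶e one)) , e⟶v) , perm)
        where
        open GapWalks (gapWalks walkQ l u x B v r eq)
        cutD : Walk v (l′ ++ [ s ]) s × s ⟶ s′ × Walk s′ (s′ ∷ r′) a
        cutD = cut l′ (subst (λ D → Walk v D a) eq′ walkD)
        w₁ : Walk v (l′ ++ [ s ]) s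
        w₁ = proj₁ cutD
        w₂ : Walk s′ (s′ ∷ r′) a
        w₂ = proj₂ (proj₂ cutD)
        perm : (l′ ++ [ s ]) ++ y ∷ (l ++ u ∷ x ∷ B) ++ (s′ ∷ r′) ++ [ e ] ↭ V
        perm = ↭-trans (solve 8 (λ l′ s y l u b r′ e → (l′ ⊕ s) ⊕ (y ⊕ ((l ⊕ (u ⊕ b)) ⊕ (r′ ⊕ e))) ⊜
            (l ⊕ (u ⊕ (b ⊕ (l′ ⊕ (s ⊕ r′))))) ⊕ (e ⊕ y))
            ↭-refl l′ [ s ] [ y ] l [ u ] (x ∷ B) (s′ ∷ r′) [ e ])
          (↭-trans (++⁺ʳ ey (↭-trans (++⁺ˡ l (++⁺ˡ (u ∷ x ∷ B) (↭-reflexive (sym eq′))))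
              (↭-reflexive (sym eq)))) cover)
      -- Counts the pairs `(p , e)` and `(e , y)`; because `y ⟶ x`, no arc enters `y` from `A`, the
      -- part of `Q` before the gap.
      ...   | inj₂ bound = gap-arith₂ n (length A) (length B′) (length D) (outTo p V) (inFrom e V)
          (outTo e V) (inFrom y V) (inFrom y D) (outTo p D)
        (≤-reflexive (trans (sym (split₄ length-additive A B′ D ey cover′)) ∣V∣))
        (heavy-xe p∈ (proj₁ (far p∈B))) heavy-ey
        (≤-trans (≤-reflexive (split₄ (inFrom-additive y) A B′ D ey cover′))
          (gap-y (length B′) (inFrom y A) (inFrom y B′) (inFrom y D) (inFrom y ey)
            (#-none (_⟶? y) λ w∈ w⟶y → before w∈ w⟶y y⟶x) (#≤length (_⟶? y) B′)
            (#-none (_⟶? y) λ { (here refl) → e↛y ; (there (here refl)) → loopless })))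
        (≤-trans (≤-reflexive (split₄ (outTo-additive p) A B′ D ey cover′))
          (gap-p (length A) (length B′) (outTo p A) (outTo p B′) (outTo p D) (outTo p ey)
            (#≤length (p ⟶?_) A) (#<length (p ⟶?_) p∈B loopless)
                (#<length (p ⟶?_) (here refl) (proj₁ (far p∈B)))))
        bound
        (≤-trans (≤-reflexive (cong₂ _+_ (split₃′ (outTo-additive e)) (split₃′ (inFrom-additive e))))
          (gap-e (length D) (length A) (outTo e Q̂) (outTo e B′) (outTo e [ e ]) (inFrom e Q̂)
              (inFrom e B′) (inFrom e [ e ])
            (≤-trans insertE (s≤s (≤-reflexive (trans (length-++ D) (cong (length D +_) refl)))))
            (#-none (e ⟶?_) λ g∈ → proj₂ (far g∈)) (#-none (_⟶? e) λ g∈ → proj₁ (far g∈))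
            (#-none (e ⟶?_) λ { (here refl) → loopless })
                (#-none (_⟶? e) λ { (here refl) → loopless })))
        where
        open GapWalks (gapWalks walkQ l u x B v r eq)
        A B′ D Q̂ : Vertices
        A = l ++ [ u ]
        B′ = x ∷ B
        D = v ∷ r
        Q̂ = D ++ y ∷ A
        p∈B : p ∈ B′
        p∈B = last∈ walkB
        p∈ : p ∈ Q
        p∈ = subst (p ∈_) (sym eq) (∈-++⁺ʳ l (there (∈-++⁺ˡ p∈B)))
        eq″ : Q ≡ A ++ B′ ++ D
        eq″ = trans eq (sym (++-assoc l [ u ] (B′ ++ D)))
        before : ∀ {w} → w ∈ A → w ⟶ y → ¬ y ⟶ x
        before w∈ = allPairs-++ A (subst (Single y) eq″ single-y) w∈ (here refl)
        cover′ : A ++ B′ ++ D ++ ey ↭ V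
        cover′ = ↭-trans (solve 4 (λ a b d e → a ⊕ (b ⊕ (d ⊕ e)) ⊜ (a ⊕ (b ⊕ d)) ⊕ e) ↭-refl A B′ D ey)
          (↭-trans (++⁺ʳ ey (↭-reflexive (sym eq″))) cover)
        cover″ : Q̂ ++ B′ ++ [ e ] ↭ V
        cover″ = ↭-trans (solve 5 (λ d y a b e → (d ⊕ (y ⊕ a)) ⊕ (b ⊕ e) ⊜ a ⊕ (b ⊕ (d ⊕ (e ⊕ y))))
            ↭-refl D [ y ] A B′ [ e ]) cover′
        split₃′ : ∀ {κ} → Additive κ → κ V ≡ κ Q̂ + (κ B′ + κ [ e ])
        split₃′ {κ} α = trans (split₂ α Q̂ (B′ ++ [ e ]) cover″)
            (cong (κ Q̂ +_) (Additive.++-hom α B′ [ e ]))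
        -- `B` leads from the end `u` of `Q̂` back to its start `v`, so inserting `e` would give a
        -- Hamiltonian cycle.
        insertE : inFrom e Q̂ + outTo e Q̂ ≤ 1 + length Q̂
        insertE with insert (join walkD a⟶y (y⟶b ◂ walkA)) (one {e})
        ... | inj₂ bound = bound
        ... | inj₁ i = ⊥-elim (¬ham (_ , (_ , _ , join (Inserted.walk i) u⟶x walkB , p⟶v) ,
          ↭-trans (++⁺ʳ B′ (Inserted.perm i))
              (↭-trans (solve 3 (λ q e b → (q ⊕ e) ⊕ b ⊜ q ⊕ (b ⊕ e)) ↭-refl Q̂ [ e ] B′) cover″)))

      -- A gap of `e` on the cycle through `Q` and `y` would let an end of the gap trade places with
      -- `e`: the first vertex is excluded by `noGap`, the last by injectivity, as `M y e` holds and
      -- `y` is not in `Q`.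
      single-e : Single e Q
      single-e with tightGap (_⟶? e) (e ⟶?_) Q
      ... | inj₁ single = single
      ... | inj₂ (gap l u B v r eq u⟶e e⟶v far)
        with gapOutcome walkQ (one {y}) a⟶y y⟶b
          (↭-trans (++⁺ˡ Q (solve 2 (λ e y → y ⊕ e ⊜ e ⊕ y) ↭-refl
              [ e ] [ y ])) cover) l u B v r eq u⟶e e⟶v far
      ...   | isFirst m c cover′ = ⊥-elim (noGap l u _ _ v r eq u⟶e e⟶v far m c cover′)
      ...   | isLast x∈ m _ _ =
          ⊥-elim (≢y (subst (_ ∈_) (sym eq) (∈-++⁺ʳ l (there (∈-++⁺ˡ x∈)))) (M-injective m Mye))

      single-bound : ∀ {z s xs t} → Walk s xs t → Single z xs → inFrom z xs + outTo z xs ≤ 1 + length xs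
      single-bound {z} w single with crossing (_⟶? z) (z ⟶?_) w
      ... | inj₂ bound = bound
      ... | inj₁ (at l u v r refl u⟶z z⟶v) = ⊥-elim (allPairs-++ (l ++ [ u ])
        (subst (Single z) (sym (++-assoc l [ u ] (v ∷ r))) single) (∈-++⁺ʳ l (here refl))
            (here refl) u⟶z z⟶v)

      ey-o : outTo e ey ≤ 0
      ey-o = #-none (e ⟶?_) λ { (here refl) → loopless ; (there (here refl)) → e↛y }
      ey-i : inFrom y ey ≤ 0
      ey-i = #-none (_⟶? y) λ { (here refl) → e↛y ; (there (here refl)) → loopless }

      module _ (l : Vertices) (u v : Fin n) (r : Vertices) (eq : Q ≡ l ++ u ∷ v ∷ r) (u⟶y : u ⟶ y)
          (e⟶v : e ⟶ v) where
        private
          U W : Vertices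
          U = l ++ [ u ]
          W = v ∷ r

          eq′ : Q ≡ U ++ W
          eq′ = trans eq (sym (++-assoc l [ u ] W))

          cutQ : Walk b U u × u ⟶ v × Walk v W a
          cutQ = cut l (subst (λ Q → Walk b Q a) eq walkQ)

          walkU : Walk b U u
          walkU = proj₁ cutQ

          walkW : Walk v W a
          walkW = proj₂ (proj₂ cutQ)

          coverUW : U ++ W ++ ey ↭ V
          coverUW = ↭-trans (↭-reflexive (trans (sym (++-assoc U W ey))
              (cong (_++ ey) (sym eq′)))) cover

          u∈ : u ∈ U
          u∈ = ∈-++⁺ʳ l (here refl)

          u∈Q : u ∈ Q
          u∈Q = subst (u ∈_) (sym eq′) (∈-++⁺ˡ u∈)

          v∈Q : v ∈ Q
          v∈Q = subst (v ∈_) (sym eq′) (∈-++⁺ʳ U (here refl))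

          singles : ∀ {z} → Single z Q → Single z (U ++ W)
          singles {z} = subst (Single z) eq′

          y↛W : ∀ {w} → w ∈ W → ¬ y ⟶ w
          y↛W w∈ = allPairs-++ U (singles single-y) u∈ w∈ u⟶y

          U↛e : ∀ {w} → w ∈ U → ¬ w ⟶ e
          U↛e w∈ w⟶e = allPairs-++ U (singles single-e) w∈ (here refl) w⟶e e⟶v

        W-bound : inFrom y W + outTo u W ≤ 1 + length W
        W-bound with crossing (_⟶? y) (u ⟶?_) walkW
        ... | inj₂ bound = bound
        -- The cycle runs `b … u`, `x′ … a`, `e`, `v … x`, `y` and back to `b`.
        ... | inj₁ (at l₂ x x′ r₂ eq₂ x⟶y u⟶x′) = ⊥-elim (¬ham (_ ,
          (_ , _ , join walkU u⟶x′ (join w₂ a⟶e (e⟶v ◂ join w₁ x⟶y one)) , y⟶b) ,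
          ↭-trans (solve 6 (λ u l x r e y → u ⊕ (r ⊕ (e ⊕ ((l ⊕ x) ⊕ y))) ⊜
              u ⊕ ((l ⊕ (x ⊕ r)) ⊕ (e ⊕ y))) ↭-refl U l₂ [ x ] (x′ ∷ r₂) [ e ] [ y ])
            (↭-trans (++⁺ˡ U (++⁺ʳ ey (↭-reflexive (sym eq₂)))) coverUW)))
          where
          cutW : Walk v (l₂ ++ [ x ]) x × x ⟶ x′ × Walk x′ (x′ ∷ r₂) a
          cutW = cut l₂ (subst (λ W → Walk v W a) eq₂ walkW)
          w₁ : Walk v (l₂ ++ [ x ]) x
          w₁ = proj₁ cutW
          w₂ : Walk x′ (x′ ∷ r₂) a
          w₂ = proj₂ (proj₂ cutW)

        U-bound : inFrom v U + outTo e U ≤ 1 + length U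
        U-bound with crossing (_⟶? v) (e ⟶?_) walkU
        ... | inj₂ bound = bound
        -- The cycle runs `b … x`, `v … a`, `e`, `x′ … u`, `y` and back to `b`.
        ... | inj₁ (at l₃ x x′ r₃ eq₃ x⟶v e⟶x′) = ⊥-elim (¬ham (_ ,
          (_ , _ , join w₁ x⟶v (join walkW a⟶e (e⟶x′ ◂ join w₂ u⟶y one)) , y⟶b) ,
          ↭-trans (solve 6 (λ w l x r e y → (l ⊕ x) ⊕ (w ⊕ (e ⊕ (r ⊕ y))) ⊜
              (l ⊕ (x ⊕ r)) ⊕ (w ⊕ (e ⊕ y))) ↭-refl W l₃ [ x ] (x′ ∷ r₃) [ e ] [ y ])
            (↭-trans (++⁺ʳ (W ++ ey) (↭-reflexive (sym eq₃))) coverUW)))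
          where
          cutU : Walk b (l₃ ++ [ x ]) x × x ⟶ x′ × Walk x′ (x′ ∷ r₃) u
          cutU = cut l₃ (subst (λ U → Walk b U u) eq₃ walkU)
          w₁ : Walk b (l₃ ++ [ x ]) x
          w₁ = proj₁ cutU
          w₂ : Walk x′ (x′ ∷ r₃) u
          w₂ = proj₂ (proj₂ cutU)

        private
          κ : Vertices → ℕ
          κ xs = (outTo y xs + inFrom v xs) + ((outTo u xs + inFrom e xs) + (outTo e xs + inFrom y xs))

          κ-additive : Additive κ
          κ-additive = (outTo-additive y +ᵃ inFrom-additive v) +ᵃ ((outTo-additive u +ᵃ inFrom-additive e) +ᵃ (outTo-additive e +ᵃ inFrom-additive y))

          splitUW : ∀ {κ} → Additive κ → κ V ≡ κ U + (κ W + κ ey)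
          splitUW {κ} α = trans (split₂ α U (W ++ ey) coverUW) (cong (κ U +_) (Additive.++-hom α W ey))

        -- 3n ≤ κ V ≤ 3n − 2.
        noCrossing : ⊥
        noCrossing = final-arith n (length U) (length W) (κ U) (κ W) (κ ey)
          (≤-reflexive (trans (sym (splitUW length-additive)) ∣V∣))
          (≤-trans (heavy-yx v∈Q (y↛W (here refl)) ⊞ heavy-xe u∈Q (U↛e u∈) ⊞ heavy-ey)
              (≤-reflexive (splitUW κ-additive)))
          (final-U (length U) (outTo y U) (inFrom v U) (outTo u U) (inFrom e U) (outTo e U) (inFrom y U)
            (single-bound walkU (allPairs-++ˡ U (singles single-y))) U-bound
            (#<length (u ⟶?_) u∈ loopless) (#-none (_⟶? e) U↛e))
          (final-W (length W) (outTo y W) (inFrom v W) (outTo u W) (inFrom e W) (outTo e W) (inFrom y W)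
            W-bound (single-bound walkW (allPairs-++ʳ U (singles single-e)))
            (#<length (_⟶? v) (here refl) loopless) (#-none (y ⟶?_) y↛W))
          (final-X (outTo y ey) (inFrom v ey) (outTo u ey) (inFrom e ey) (outTo e ey) (inFrom y ey)
            (#-none (y ⟶?_) λ { (here refl) → y↛e ; (there (here refl)) → loopless })
            (s≤s⁻¹ (#<length (_⟶? v) (there (here refl)) (y↛W (here refl))))
            (s≤s⁻¹ (#<length (u ⟶?_) (here refl) (U↛e u∈)))
            (#-none (_⟶? e) λ { (here refl) → loopless ; (there (here refl)) → y↛e })
            ey-o ey-i)

      -- Either an in-neighbour of `y` directly precedes an out-neighbour of `e` on `Q`, or the pair
      -- `(e , y)` has degree sum at most `n - 1`.
      impossible : ⊥
      impossible with crossing (_⟶? y) (e ⟶?_) walkQ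
      ... | inj₁ (at l u v r eq u⟶y e⟶v) = noCrossing l u v r eq u⟶y e⟶v
      ... | inj₂ bound = cross-arith n (length Q) (outTo e Q) (outTo e ey) (inFrom y Q)
          (inFrom y ey) bound
        (≤-trans heavy-ey (≤-reflexive (cong₂ _+_ (split₂ (outTo-additive e) Q ey cover)
            (split₂ (inFrom-additive y) Q ey cover))))
        ey-o ey-i (≤-reflexive (trans (sym (split₂ length-additive Q ey cover)) ∣V∣))

    Q++G : ∀ {Q G P H} (ε : Ear Q G P H) → Cycle (Q ++ G)
    Q++G ε = _ , _ , join walkQ a⟶e walkG , f⟶b
      where
      open Ear ε

    -- Induction on `d⁺(y)`. An exchange with `M x y` leads to a missed vertex `x` of smaller
    -- out-degree by `decreases`, so only the exchange with `M y e` remains.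
    noneMissesOne : ∀ {C y} → Cycle C → C ++ [ y ] ↭ V → ⊥
    noneMissesOne {C} {y} c cover = <-rec
      (λ d → ∀ {C y} → Cycle C → C ++ [ y ] ↭ V → outTo y V ≡ d → ⊥)
      (λ { d rec {C} {y} c cover refl → step c cover (λ c′ cover′ lt → rec lt c′ cover′ refl) })
      (outTo y V) c cover refl
      where
      step : ∀ {C y} → Cycle C → C ++ [ y ] ↭ V →
        (∀ {C′ x} → Cycle C′ → C′ ++ [ x ] ↭ V → outTo x V < outTo y V → ⊥) → ⊥
      step {C} {y} c cover smaller with earFrom longest₁ c cover (s≤s z≤n)
      ... | _ , _ , _ , _ , ε , perm = tighten contra ε perm
        where
        contra : ∀ {Q G P H} (ε : Ear Q G P H) → P ++ H ↭ [ y ] → Tight ε → ⊥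
        contra {H = H} ε perm τ with Block.block ε τ
        contra {Q} {G} ε perm τ | dropLast refl m a⟶z z⟶b w cover′ with refl ← ↭-singleton-inv perm =
          smaller (_ , _ , join w a⟶z one , z⟶b)
            (↭-trans (solve 3 (λ q f z → (q ⊕ z) ⊕ f ⊜ q ⊕ (f ⊕ z)) ↭-refl _ [ _ ] [ y ]) cover′)
            (decreases m (Block.P↛G ε τ (here refl) (last∈ (Ear.walkG ε)))
              (_ , _ , join w a⟶z one , z⟶b)
              (↭-trans (solve 3 (λ q f z → (q ⊕ z) ⊕ f ⊜ q ⊕ (f ⊕ z)) ↭-refl _ [ _ ] [ y ]) cover′))
        contra {Q} {G} ε perm τ | dropFirst refl m a⟶z z⟶b w cover′ transfer with refl ← ↭-singleton-inv perm
          with tightGap (_⟶? y) (y ⟶?_) Q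
        -- `Q′` arises from `Q` by inserting vertices not adjacent to `y`, so the order of the
        -- neighbours of `y` survives.
        ... | inj₁ single = Final.impossible w cover′ m (Ear.a⟶e ε) a⟶z z⟶b
          (Block.G↛P ε τ (first∈ (Ear.walkG ε)) (here refl))
              (Block.P↛G ε τ (here refl) (first∈ (Ear.walkG ε)))
          (transfer (λ g∈ → Block.G↛P ε τ g∈ (here refl) , Block.P↛G ε τ (here refl) g∈) single)
          (Q++G ε) (↭-trans (↭-reflexive (++-assoc Q G [ y ])) (Ear.cover ε))
        ... | inj₂ (gap l u B v r eq u⟶y y⟶v far)
          with gapOutcome (Ear.walkQ ε) (Ear.walkG ε) (Ear.a⟶e ε) (Ear.f⟶b ε)
              (Ear.cover ε) l u B v r eq u⟶y y⟶v far
        ...   | isLast x∈ m′ c cover″ = smaller c cover″ (decreases m′ (proj₂ (far x∈)) c cover″)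
        -- `M` already links `y` to `e`, which lies in `G`, whereas the gap lies in `Q`.
        ...   | isFirst m′ _ _ = unique⇒≢ Q (cover-unique (Ear.cover ε))
          (subst (_ ∈_) (sym eq) (∈-++⁺ʳ l (there (here refl)))) (∈-++⁺ˡ (first∈ (Ear.walkG ε)))
              (M-functional m′ m)

    -- Cycles that miss several vertices

    module Detours {Q G H y} (ε : Ear Q G [ y ] H) (τ : Tight ε) where
      open Ear ε
      open Tight τ

      p≡y : p ≡ y
      p≡y = start walkP

      q≡y : q ≡ y
      q≡y with unsnoc walkP
      ... | inj₁ (refl , _) = refl
      ... | inj₂ ([] , _ , _ , () , _)
      ... | inj₂ (_ ∷ [] , _ , () , _ , _)
      ... | inj₂ (_ ∷ _ ∷ _ , _ , () , _ , _)

      pick₂ : ∀ {w w′} → w ∈ H → w′ ∈ H → w ⟶ w′ → ∃ λ H′ → H ↭ w ∷ w′ ∷ H′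
      pick₂ w∈ w′∈ w⟶w′ with pick w∈
      ... | H′ , H↭ with ∈-resp-↭ H↭ w′∈
      ...   | here refl = ⊥-elim (loopless w⟶w′)
      ...   | there w′∈H′ with pick w′∈H′
      ...     | H″ , H′↭ = H″ , ↭-trans H↭ (++⁺ˡ [ _ ] H′↭)

      y↛H↛G : ∀ {w x} → w ∈ H → x ∈ G → y ⟶ w → ¬ w ⟶ x
      y↛H↛G w∈ x∈ y⟶w = Block.q↛H↛G ε τ w∈ x∈ (subst (_⟶ _) (sym q≡y) y⟶w)

      G↛H↛y : ∀ {w x} → w ∈ H → x ∈ G → x ⟶ w → ¬ w ⟶ y
      G↛H↛y w∈ x∈ x⟶w w⟶y = Block.G↛H↛p ε τ x∈ w∈ x⟶w (subst (_ ⟶_) (sym p≡y) w⟶y)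

      y↛HH↛G : ∀ {w w′ x} → w ∈ H → w′ ∈ H → x ∈ G → y ⟶ w → w ⟶ w′ → ¬ w′ ⟶ x
      y↛HH↛G {w} {w′} w∈ w′∈ x∈ y⟶w w⟶w′ w′⟶x with pick₂ w∈ w′∈ w⟶w′
      ... | H′ , H↭ = early (subst (λ p → Walk p (y ∷ w ∷ w′ ∷ []) w′) (sym p≡y)
          (y⟶w ◂ w⟶w′ ◂ one)) w′⟶x x∈
        (++⁺ˡ [ y ] (↭-sym H↭))

      G↛HH↛y : ∀ {w w′ x} → w ∈ H → w′ ∈ H → x ∈ G → x ⟶ w → w ⟶ w′ → ¬ w′ ⟶ y
      G↛HH↛y {w} {w′} w∈ w′∈ x∈ x⟶w w⟶w′ w′⟶y with pick₂ w∈ w′∈ w⟶w′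
      ... | H′ , H↭ = late x∈ x⟶w (subst (λ q → Walk w (w ∷ w′ ∷ y ∷ []) q) (sym q≡y)
          (w⟶w′ ◂ w′⟶y ◂ one))
        (↭-trans (solve 3 (λ w y h → w ⊕ (y ⊕ h) ⊜ y ⊕ (w ⊕ h)) ↭-refl (w ∷ w′ ∷ []) [ y ] H′)
            (++⁺ˡ [ y ] (↭-sym H↭)))

    -- The cycles before and after the exchange both miss `H`. `TwoCycles` makes `H` empty, although
    -- `P` is a single vertex and at least two vertices are missed.
    noneMissesMore : ∀ {x y R Q G P H} (ε : Ear Q G P H) → P ++ H ↭ x ∷ y ∷ R → Tight ε → ⊥
    noneMissesMore {Q = Q} {G} {P} {H} ε perm τ with Block.block ε τ
    ... | dropFirst {Q′ = Q′} refl m a⟶z z⟶b w cover′ _ = more H perm TwoCycle.H-empty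
      where
      open Ear ε
      open Block ε τ using (G↛P)
      open Detours ε τ
      e∈ : e ∈ G
      e∈ = first∈ walkG
      module TwoCycle = TwoCycles {H = H} longest (Q++G ε)
          (↭-trans (↭-reflexive (++-assoc Q G _)) cover)
        (_ , _ , join w a⟶z one , z⟶b)
        (↭-trans (solve 4 (λ q x z h → (q ⊕ z) ⊕ (x ⊕ h) ⊜ q ⊕ (x ⊕ (z ⊕ h))) ↭-refl
            Q′ [ e ] [ _ ] H) cover′)
        m (G↛P e∈ (here refl)) (λ w∈ → G↛H↛y w∈ e∈) (λ w∈ → y↛H↛G w∈ e∈) (λ w∈ w′∈ → y↛HH↛G w∈ w′∈ e∈)
      more : ∀ {x y z R} H → z ∷ H ↭ x ∷ y ∷ R → (∀ {w} → w ∈ H → ⊥) → ⊥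
      more [] p _ with () ← ↭-length p
      more (_ ∷ _) _ none = none (here refl)
    ... | dropLast {Q′ = Q′} refl m a⟶z z⟶b w cover′ = more H perm TwoCycle.H-empty
      where
      open Ear ε
      open Block ε τ using (P↛G)
      open Detours ε τ
      f∈ : f ∈ G
      f∈ = last∈ walkG
      module TwoCycle = TwoCycles {H = H} longest
        (_ , _ , join w a⟶z one , z⟶b)
        (↭-trans (solve 4 (λ q x z h → (q ⊕ z) ⊕ (x ⊕ h) ⊜ q ⊕ (x ⊕ (z ⊕ h))) ↭-refl
            Q′ [ f ] [ _ ] H) cover′)
        (Q++G ε) (↭-trans (↭-reflexive (++-assoc Q G _)) cover)
        m (P↛G (here refl) f∈) (λ w∈ → y↛H↛G w∈ f∈) (λ w∈ → G↛H↛y w∈ f∈) (λ w∈ w′∈ → G↛HH↛y w∈ w′∈ f∈)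
      more : ∀ {x y z R} H → z ∷ H ↭ x ∷ y ∷ R → (∀ {w} → w ∈ H → ⊥) → ⊥
      more [] p _ with () ← ↭-length p
      more (_ ∷ _) _ none = none (here refl)

    -- Strong induction on the number of missed vertices: the induction hypothesis says that the
    -- cycle at hand is a longest one.
    noneMisses : ∀ {C R} → Cycle C → C ++ R ↭ V → ⊥
    noneMisses {R = R} c cover =
        <-rec (λ h → ∀ {C R} → Cycle C → C ++ R ↭ V → length R ≡ h → ⊥) step (length R) c cover refl
      where
      step : ∀ h → (∀ {h′} → h′ < h → ∀ {C R} → Cycle C → C ++ R ↭ V → length R ≡ h′ → ⊥) →
        ∀ {C R} → Cycle C → C ++ R ↭ V → length R ≡ h → ⊥
      step _ rec {C} {[]} c cover refl = ¬ham (C , c , subst (_↭ V) (++-identityʳ C) cover)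
      step _ rec {C} {y ∷ []} c cover refl = noneMissesOne c cover
      step _ rec {C} {y ∷ z ∷ R} c cover refl
        with earFrom (λ c′ cover′ → ≮⇒≥ λ lt → rec lt c′ cover′ refl) c cover (s≤s z≤n)
      ... | _ , _ , _ , _ , ε , perm = tighten noneMissesMore ε perm

  -- An excursion from a one-vertex set has to return to that vertex.
  cycleExists : ∃₂ λ C R → Cycle C × C ++ R ↭ V
  cycleExists = within V ↭-refl ∣V∣
    where
    within : ∀ xs → xs ↭ V → length xs ≡ n → ∃₂ λ C R → Cycle C × C ++ R ↭ V
    within [] _ refl = ⊥-elim (<⇒≱ n>2 z≤n)
    within (_ ∷ []) _ refl = ⊥-elim (<⇒≱ n>2 (s≤s z≤n))
    within (v ∷ w ∷ R) cover _ with excursion [ v ] (w ∷ R) cover (s≤s z≤n) (s≤s z≤n)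
    ... | record { c∈T = here refl ; t∈T = here refl ; c⟶p = c⟶p ; walk = walk ; s⟶t = s⟶t ; perm =
        perm } =
      _ , _ , (_ , _ , c⟶p ◂ walk , s⟶t) , ↭-trans (++⁺ˡ [ v ] perm) cover

  -- Doubly negated because the argument is by contradiction; a finite search recovers an actual
  -- cycle.
  ¬¬hamiltonian : ¬ ¬ Hamiltonian
  ¬¬hamiltonian ¬ham with C , R , c , cover ← cycleExists = noneMisses ¬ham c cover

-- Deciding Hamiltonicity by exhaustive search

module Search {n : ℕ} (_⟶_ : Rel (Fin n) 0ℓ) (_⟶?_ : Decidable₂ _⟶_) where

  open Walks _⟶_
  open import Data.List.Relation.Unary.Unique.DecPropositional (Fin._≟_ {n}) using (unique?)
  open import Data.List.Membership.DecPropositional (Fin._≟_ {n}) using (_∈?_)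

  -- Collects the fields of `HamiltonianCycle` over a plain list, which makes them decidable and
  -- searchable.
  IsHamiltonian : List (Fin n) → Set
  IsHamiltonian [] = ⊥
  IsHamiltonian (x ∷ xs) =
    Unique (x ∷ xs) × All (uncurry _⟶_) (cyclicPairs x xs) × (∀ v → v ∈ x ∷ xs)

  isHamiltonian? : ∀ xs → Dec (IsHamiltonian xs)
  isHamiltonian? [] = no λ ()
  isHamiltonian? (x ∷ xs) =
    unique? (x ∷ xs) ×-dec All.all? (λ (u , v) → u ⟶? v) (cyclicPairs x xs) ×-dec Fin.all? (_∈? x ∷ xs)

  search : ∀ k {P : List (Fin n) → Set} → (∀ xs → Dec (P xs)) → Dec (∃ λ xs → length xs ≡ k × P xs)
  search zero P? with P? []
  ... | yes p = yes ([] , refl , p)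
  ... | no ¬p = no λ { ([] , _ , p) → ¬p p }
  search (suc k) P? with Fin.any? (λ x → search k (λ xs → P? (x ∷ xs)))
  ... | yes (x , xs , eq , p) = yes (x ∷ xs , cong suc eq , p)
  ... | no ¬p = no λ { (x ∷ xs , eq , p) → ¬p (x , xs , suc-injective eq , p) }

  walkArcs : ∀ {s x xs t z} → Walk s (x ∷ xs) t → t ⟶ z → All (uncurry _⟶_) (zip (x ∷ xs) (xs ∷ʳ z))
  walkArcs one e = e ∷ []
  walkArcs (e ◂ one) e′ = e ∷ e′ ∷ []
  walkArcs (e ◂ w@(_ ◂ _)) e′ = e ∷ walkArcs w e′

  isHamiltonian : ∀ {C} → Cycle C → C ↭ allFin n → IsHamiltonian C
  isHamiltonian {[]} (_ , _ , () , _) _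
  isHamiltonian {x ∷ xs} (_ , _ , w , t⟶s) cover with refl ← start w =
    PermS.Unique-resp-↭ (setoid (Fin n)) (↭⇒↭ₛ (↭-sym cover)) (allFin⁺ n) , walkArcs w t⟶s ,
    λ v → ∈-resp-↭ (↭-sym cover) (∈-allFin v)

-- The arcs of a cycle as an injective partial function

module _ {A : Set} where

  zip-∈ˡ : ∀ {u v : A} as bs → (u , v) ∈ zip as bs → u ∈ as
  zip-∈ˡ (a ∷ as) (b ∷ bs) (here refl) = here refl
  zip-∈ˡ (a ∷ as) (b ∷ bs) (there m) = there (zip-∈ˡ as bs m)

  zip-∈ʳ : ∀ {u v : A} as bs → (u , v) ∈ zip as bs → v ∈ bs
  zip-∈ʳ (a ∷ as) (b ∷ bs) (here refl) = here refl
  zip-∈ʳ (a ∷ as) (b ∷ bs) (there m) = there (zip-∈ʳ as bs m)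

  zip-functional : ∀ {u v w : A} as bs → Unique as → (u , v) ∈ zip as bs → (u , w) ∈ zip as bs → v ≡ w
  zip-functional (a ∷ as) (b ∷ bs) _ (here refl) (here refl) = refl
  zip-functional (a ∷ as) (b ∷ bs) (a∉ ∷ _) (here refl) (there m) =
      ⊥-elim (All.lookup a∉ (zip-∈ˡ as bs m) refl)
  zip-functional (a ∷ as) (b ∷ bs) (a∉ ∷ _) (there m) (here refl) =
      ⊥-elim (All.lookup a∉ (zip-∈ˡ as bs m) refl)
  zip-functional (a ∷ as) (b ∷ bs) (_ ∷ u) (there m) (there m′) = zip-functional as bs u m m′

  zip-injective : ∀ {u v w : A} as bs → Unique bs → (u , w) ∈ zip as bs → (v , w) ∈ zip as bs → u ≡ v
  zip-injective (a ∷ as) (b ∷ bs) _ (here refl) (here refl) = refl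
  zip-injective (a ∷ as) (b ∷ bs) (b∉ ∷ _) (here refl) (there m) =
      ⊥-elim (All.lookup b∉ (zip-∈ʳ as bs m) refl)
  zip-injective (a ∷ as) (b ∷ bs) (b∉ ∷ _) (there m) (here refl) =
      ⊥-elim (All.lookup b∉ (zip-∈ʳ as bs m) refl)
  zip-injective (a ∷ as) (b ∷ bs) (_ ∷ u) (there m) (there m′) = zip-injective as bs u m m′

  -- Successors lead from any entry forward to `z`. On a cycle `z = x`, so a nonempty closed set
  -- contains the start, and `closed⇒all` gives the rest.
  closed⇒last : ∀ {x z} xs (S : A → Set) → (∀ {u v} → (u , v) ∈ zip (x ∷ xs) (xs ∷ʳ z) → S u → S v) →
    ∀ {u} → u ∈ x ∷ xs → S u → S z
  closed⇒last [] S closed (here refl) s = closed (here refl) s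
  closed⇒last (y ∷ xs) S closed (here refl) s =
    closed⇒last xs S (λ m → closed (there m)) (here refl) (closed (here refl) s)
  closed⇒last (y ∷ xs) S closed (there m) s = closed⇒last xs S (λ m → closed (there m)) m s

  closed⇒all : ∀ {x z} xs (S : A → Set) → (∀ {u v} → (u , v) ∈ zip (x ∷ xs) (xs ∷ʳ z) → S u → S v) →
    S x → All S (x ∷ xs)
  closed⇒all [] S closed s = s ∷ []
  closed⇒all (y ∷ xs) S closed s = s ∷ closed⇒all xs S (λ m → closed (there m)) (closed (here refl) s)

  two-values : ∀ {u v : A} {xs} → Unique xs → All (λ w → w ≡ u ⊎ w ≡ v) xs → length xs ≤ 2
  two-values [] [] = z≤n
  two-values (_ ∷ []) (_ ∷ []) = s≤s z≤n
  two-values (_ ∷ _ ∷ []) (_ ∷ _ ∷ []) = s≤s (s≤s z≤n)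
  two-values ((x≢y ∷ x≢z ∷ _) ∷ (y≢z ∷ _) ∷ _) (x ∷ y ∷ z ∷ _) = ⊥-elim (distinct x y z)
    where
    distinct : _ ⊎ _ → _ ⊎ _ → _ ⊎ _ → ⊥
    distinct (inj₁ p) (inj₁ q) _ = x≢y (trans p (sym q))
    distinct (inj₂ p) (inj₂ q) _ = x≢y (trans p (sym q))
    distinct (inj₁ p) _ (inj₁ r) = x≢z (trans p (sym r))
    distinct (inj₂ p) _ (inj₂ r) = x≢z (trans p (sym r))
    distinct _ (inj₁ q) (inj₁ r) = y≢z (trans q (sym r))
    distinct _ (inj₂ q) (inj₂ r) = y≢z (trans q (sym r))

  -- In a cycle with at least three vertices {u , v} is not closed under successors.
  cyclicPairs-asym : ∀ {x : A} {xs u v} → Unique (x ∷ xs) → 2 < length (x ∷ xs) →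
    (u , v) ∈ cyclicPairs x xs → ¬ (v , u) ∈ cyclicPairs x xs
  cyclicPairs-asym {x} {xs} {u} {v} unique long uv vu =
    <⇒≱ long (two-values unique (closed⇒all xs S closed (closed⇒last xs S closed (zip-∈ˡ _ _ uv)
        (inj₁ refl))))
    where
    S : A → Set
    S w = w ≡ u ⊎ w ≡ v
    closed : ∀ {w w′} → (w , w′) ∈ cyclicPairs x xs → S w → S w′
    closed m (inj₁ refl) = inj₂ (zip-functional _ _ unique m uv)
    closed m (inj₂ refl) = inj₁ (zip-functional _ _ unique m vu)

-- Two arc-disjoint Hamiltonian cycles

corollary2 : (n : ℕ) → n > 2 → (D : Digraph n) → let open Digraph D in
    (∀ (u v : Fin n) → u ≢ v → ¬ (u ⟶ v) → outDegree u + inDegree v ≥ n + 2) →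
    ∃₂ λ (C₁ C₂ : HamiltonianCycle D) → ArcDisjoint D C₁ C₂
corollary2 n n>2 D dense = conclude (decidable-stable (search n isHamiltonian?) λ none →
    -- First cycle: no exceptional pairs, and the surplus `2` in the degree condition is given away.
    Ore.¬¬hamiltonian _⟶_ _⟶?_ (noLoop _) (λ _ _ → ⊥) (λ _ _ → no λ ()) (λ ()) (λ ()) (λ ())
      (λ u≢v ¬e _ → ≤-trans (m≤m+n n 2) (dense# u≢v ¬e)) n>2
      λ (C , c , cover) → none (C , trans (↭-length cover) (length-tabulate _) , isHamiltonian c cover))
  where
  open Digraph D
  open Search _⟶_ _⟶?_

  dense# : ∀ {u v} → u ≢ v → ¬ u ⟶ v → n + 2 ≤ # (u ⟶?_) (allFin n) + # (_⟶? v) (allFin n)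
  dense# {u} {v} u≢v ¬e = subst₂ (λ o i → n + 2 ≤ o + i)
    (sym (#-def (u ⟶?_) (allFin n))) (sym (#-def (_⟶? v) (allFin n))) (dense u v u≢v ¬e)

  conclude : (∃ λ xs → length xs ≡ n × IsHamiltonian xs) →
    ∃₂ λ (C₁ C₂ : HamiltonianCycle D) → ArcDisjoint D C₁ C₂
  conclude (x ∷ xs , ∣xs∣ , unique , arcs , spanning) =
      finish (decidable-stable (Rest.search n Rest.isHamiltonian?) λ none →
      -- Second cycle: the exceptional pairs are the deleted arcs, about whose ends the degree
      -- condition on `D` says nothing.
      Ore.¬¬hamiltonian _⟶′_ _⟶′?_ (λ (e , _) → noLoop _ e) M M?
        (zip-functional _ _ unique) (zip-injective _ _ (unique-rotate unique))
        (cyclicPairs-asym unique (subst (2 <_) (sym ∣xs∣) n>2))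
        heavy n>2
        λ (C , c , cover) → none (C , trans (↭-length cover)
            (length-tabulate _) , Rest.isHamiltonian c cover))
    where
    M : Rel (Fin n) 0ℓ
    M u v = (u , v) ∈ cyclicPairs x xs

    M? : Decidable₂ M
    M? u v = Any.any? (≡-dec Fin._≟_ Fin._≟_ (u , v)) (cyclicPairs x xs)

    _⟶′_ : Rel (Fin n) 0ℓ
    u ⟶′ v = u ⟶ v × ¬ M u v

    _⟶′?_ : Decidable₂ _⟶′_
    u ⟶′? v = (u ⟶? v) ×-dec ¬? (M? u v)

    module Rest = Search _⟶′_ _⟶′?_

    -- The heads of the arcs are the vertices of the cycle shifted by one place.
    unique-rotate : Unique (x ∷ xs) → Unique (xs ∷ʳ x)
    unique-rotate = PermS.Unique-resp-↭ (setoid (Fin n)) (↭⇒↭ₛ (∷↭∷ʳ x xs))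

    keep : ∀ {u v} → u ⟶ v → u ⟶′ v ⊎ M u v
    keep {u} {v} e with M? u v
    ... | yes m = inj₂ m
    ... | no ¬m = inj₁ (e , ¬m)

    out-drop : ∀ u → # (u ⟶?_) (allFin n) ≤ # (u ⟶′?_) (allFin n) + 1
    out-drop u = ≤-trans (#-cover (u ⟶?_) (u ⟶′?_) (M? u) (allFin n) keep)
      (+-monoʳ-≤ _ (#-unique (M? u) (allFin⁺ n) (zip-functional _ _ unique)))

    in-drop : ∀ v → # (_⟶? v) (allFin n) ≤ # (_⟶′? v) (allFin n) + 1
    in-drop v = ≤-trans (#-cover (_⟶? v) (_⟶′? v) (λ u → M? u v) (allFin n) keep)
      (+-monoʳ-≤ _ (#-unique (λ u → M? u v) (allFin⁺ n) (zip-injective _ _ (unique-rotate unique))))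

    -- A pair that is neither an arc of `⟶′` nor in `M` is no arc of `D`; each of the two degrees
    -- drops by at most one, which uses up the surplus `2`.
    heavy : ∀ {u v} → u ≢ v → ¬ u ⟶′ v → ¬ M u v → n ≤ # (u ⟶′?_) (allFin n) + # (_⟶′? v) (allFin n)
    heavy {u} {v} u≢v ¬e ¬m = +-cancelʳ-≤ 2 _ _ (≤-trans (dense# u≢v λ e → ¬e (e , ¬m))
      (≤-trans (out-drop u ⊞ in-drop v)
          (≤-reflexive (+-interchange (# (u ⟶′?_) (allFin n)) 1 (# (_⟶′? v) (allFin n)) 1))))

    finish : (∃ λ ys → length ys ≡ n × Rest.IsHamiltonian ys) →
      ∃₂ λ (C₁ C₂ : HamiltonianCycle D) → ArcDisjoint D C₁ C₂
    finish (y ∷ ys , _ , unique′ , arcs′ , spanning′) =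
      record { cycle = record { first = x ; rest = xs ; distinct = unique ; arcsInD =
          arcs } ; spanning = spanning } ,
      record { cycle = record { first = y ; rest = ys ; distinct = unique′ ; arcsInD =
          All.map proj₁ arcs′ } ; spanning = spanning′ } ,
      -- Every arc of the second cycle belongs to `⟶′` and thus lies outside `M`.
      λ (m , m′) → proj₂ (All.lookup arcs′ m′) m
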